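{- Let $\mathcal{G}$ be any finite group of size $N$, let $S\subseteq\mathcal{G}$ be any symmetric subset, and let $\alpha:=\frac{1}{8(\lceil\log_2N\rceil+1)}$. Then $$N\left(\alpha;\{L_s\}_{s\in S}\right)\le\lceil\log_2N\rceil+1.$$ Moreover, if $\nu:S\to\mathbb{R}_{\ge0}$ is a symmetric weight function that is not identically zero, then $N\left(\alpha/W;\{\nu(s)L_s\}_{s\in S}\right)\le\lceil\log_2N\rceil+1$, where $$W:=\frac{\max_{s\in S}\nu(s)}{\min_{s\in S:\,\nu(s)>0}\nu(s)}.$$
   Context: $S\subseteq\mathcal{G}$ is symmetric if $S=S^{ -1}$; $\nu$ is symmetric if $\nu(s)=\nu(s^{ -1})$. For $g\in\mathcal{G}$ let $\mathscr{R}(g)$ be the right regular representation on $\mathbb{R}\mathcal{G}$, $\mathscr{R}(g)(\sum_h\alpha_hh)=\sum_h\alpha_h\,hg$, and $L_g=\mathrm{Id}-\frac12(\mathscr{R}(g)+\mathscr{R}(g)^*)$, a positive semidefinite (PSD) operator. $A\preceq B$ means $B-A$ is PSD. Connectivity parameter: for a finite family $\mathcal{A}=\{A_i\}_{i\in I}$ of PSD matrices and $\alpha\ge0$, $N(\alpha;\mathcal{A})$ is the smallest integer such that for every $T\subseteq I$ with $|T|\ge N(\alpha;\mathcal{A})$ there exists $i\in T$ with $\alpha A_i\preceq\sum_{j\in T\setminus\{i\}}A_j$; if no such integer (at most $|I|$) exists, $N(\alpha;\mathcal{A})=|I|+1$. -}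

module Defs where

open import Algebra.Bundles using (Group)
open import Algebra.Bundles.Raw using (RawMonoid)
import Algebra.Definitions.RawMonoid as RawMonoidDefs
open import Data.Bool using (if_then_else_)
open import Data.Fin using (Fin)
import Data.Fin.Properties as Fin
open import Data.Fin.Subset using (Subset; _∈_; _⊆_; _-_; ∣_∣)
open import Data.Fin.Subset.Properties using (_∈?_)
open import Data.Integer using (+_)
open import Data.Nat as ℕ using (ℕ; zero; suc)
import Data.Nat.Properties as ℕ
open import Data.Nat.Logarithm using (⌈log₂_⌉)
open import Data.Product using (_×_; _,_; ∃; ∃-syntax; proj₁; proj₂)
open import Data.Rational as ℚ using (ℚ; 0ℚ; 1ℚ; ½)
import Data.Rational.Properties as ℚ
open import Data.Rational.Solver using (module +-*-Solver)
open import Data.Sum using (inj₁; inj₂)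
open import Data.Vec.Functional using (Vector)
open import Function.Bundles using (Inverse)
open import Level using (0ℓ)
open import Relation.Binary.PropositionalEquality
open import Relation.Nullary using (¬_; yes; no; does; contradiction)

------------------------------------------------------------------------
-- Real numbers, as Cauchy sequences of rationals up to _≈ᴿ_

Eventually : (ℕ → Set) → Set
Eventually P = ∃[ k ] (∀ n → k ℕ.≤ n → P n)

Cauchy : (ℕ → ℚ) → Set
Cauchy s = ∀ ε → 0ℚ ℚ.< ε →
  ∃[ k ] (∀ m n → k ℕ.≤ m → k ℕ.≤ n → ℚ.∣ s m ℚ.- s n ∣ ℚ.≤ ε)

record ℝ : Set where
  constructor mkℝ
  field
    seq    : ℕ → ℚ
    cauchy : Cauchy seq

open ℝ public

-- Opaque, like the operations below, only to keep real arithmetic from being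
-- unfolded during type checking.
infix 4 _≈ᴿ_ _≤ᴿ_ _<ᴿ_

opaque
  _≈ᴿ_ _≤ᴿ_ _<ᴿ_ : ℝ → ℝ → Set
  x ≈ᴿ y = ∀ ε → 0ℚ ℚ.< ε → Eventually λ n → ℚ.∣ seq x n ℚ.- seq y n ∣ ℚ.≤ ε
  x ≤ᴿ y = ∀ ε → 0ℚ ℚ.< ε → Eventually λ n → seq x n ℚ.≤ seq y n ℚ.+ ε
  x <ᴿ y = ∃[ ε ] (0ℚ ℚ.< ε × Eventually λ n → seq x n ℚ.+ ε ℚ.≤ seq y n)

private
  both : ∀ {P Q R : ℕ → Set} → (∀ n → P n → Q n → R n) →
         Eventually P → Eventually Q → Eventually R
  both f (k , p) (l , q) = k ℕ.⊔ l , λ n kl≤n →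
    f n (p n (ℕ.m⊔n≤o⇒m≤o k l kl≤n)) (q n (ℕ.m⊔n≤o⇒n≤o k l kl≤n))

  ½-pos : ∀ {ε} → 0ℚ ℚ.< ε → 0ℚ ℚ.< ½ ℚ.* ε
  ½-pos {ε} 0<ε = subst (ℚ._< ½ ℚ.* ε) (ℚ.*-zeroʳ ½) (ℚ.*-monoʳ-<-pos ½ 0<ε)

  halves : ∀ ε → ½ ℚ.* ε ℚ.+ ½ ℚ.* ε ≡ ε
  halves ε = trans (sym (ℚ.*-distribʳ-+ ε ½ ½)) (ℚ.*-identityˡ ε)

  *-pos : ∀ {p q} → 0ℚ ℚ.< p → 0ℚ ℚ.< q → 0ℚ ℚ.< p ℚ.* q
  *-pos {p} {q} 0<p 0<q =
    subst (ℚ._< p ℚ.* q) (ℚ.*-zeroʳ p) (ℚ.*-monoʳ-<-pos p {{ℚ.positive 0<p}} 0<q)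

  ≤-∣∣ : ∀ p → p ℚ.≤ ℚ.∣ p ∣
  ≤-∣∣ p with ℚ.≤-total 0ℚ p
  ... | inj₁ 0≤p = ℚ.≤-reflexive (sym (ℚ.0≤p⇒∣p∣≡p 0≤p))
  ... | inj₂ p≤0 = ℚ.≤-trans p≤0 (ℚ.0≤∣p∣ p)

  *-mono-≤ : ∀ {p q r s} → 0ℚ ℚ.≤ r → 0ℚ ℚ.≤ q → p ℚ.≤ q → r ℚ.≤ s →
             p ℚ.* r ℚ.≤ q ℚ.* s
  *-mono-≤ {p} {q} {r} {s} 0≤r 0≤q p≤q r≤s = ℚ.≤-trans
    (ℚ.*-monoʳ-≤-nonNeg r {{ℚ.nonNegative 0≤r}} p≤q)
    (ℚ.*-monoˡ-≤-nonNeg q {{ℚ.nonNegative 0≤q}} r≤s)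

opaque
  fromℚ : ℚ → ℝ
  fromℚ q = mkℝ (λ _ → q) λ ε 0<ε → 0 , λ _ _ _ _ →
    subst (λ p → ℚ.∣ p ∣ ℚ.≤ ε) (sym (ℚ.+-inverseʳ q)) (ℚ.<⇒≤ 0<ε)

0ᴿ 1ᴿ ½ᴿ : ℝ
0ᴿ = fromℚ 0ℚ
1ᴿ = fromℚ 1ℚ
½ᴿ = fromℚ ½

infixl 6 _+ᴿ_
infixl 7 _*ᴿ_
infix  8 -ᴿ_

opaque
  _+ᴿ_ : ℝ → ℝ → ℝ
  x +ᴿ y = mkℝ (λ n → seq x n ℚ.+ seq y n) λ ε 0<ε →
    let k , p = cauchy x (½ ℚ.* ε) (½-pos 0<ε)
        l , q = cauchy y (½ ℚ.* ε) (½-pos 0<ε)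
        open ℚ.≤-Reasoning
    in k ℕ.⊔ l , λ m n m≥ n≥ → begin
      ℚ.∣ (seq x m ℚ.+ seq y m) ℚ.- (seq x n ℚ.+ seq y n) ∣
        ≡⟨ cong ℚ.∣_∣ (rearrange (seq x m) (seq y m) (seq x n) (seq y n)) ⟩
      ℚ.∣ (seq x m ℚ.- seq x n) ℚ.+ (seq y m ℚ.- seq y n) ∣
        ≤⟨ ℚ.∣p+q∣≤∣p∣+∣q∣ (seq x m ℚ.- seq x n) (seq y m ℚ.- seq y n) ⟩
      ℚ.∣ seq x m ℚ.- seq x n ∣ ℚ.+ ℚ.∣ seq y m ℚ.- seq y n ∣
        ≤⟨ ℚ.+-mono-≤ (p m n (ℕ.m⊔n≤o⇒m≤o k l m≥) (ℕ.m⊔n≤o⇒m≤o k l n≥))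
                      (q m n (ℕ.m⊔n≤o⇒n≤o k l m≥) (ℕ.m⊔n≤o⇒n≤o k l n≥)) ⟩
      ½ ℚ.* ε ℚ.+ ½ ℚ.* ε
        ≡⟨ halves ε ⟩
      ε ∎
    where
    open +-*-Solver
    rearrange : ∀ a b c d → (a ℚ.+ b) ℚ.- (c ℚ.+ d) ≡ (a ℚ.- c) ℚ.+ (b ℚ.- d)
    rearrange = solve 4 (λ a b c d → (a :+ b) :- (c :+ d) := (a :- c) :+ (b :- d)) refl

  -ᴿ_ : ℝ → ℝ
  -ᴿ x = mkℝ (λ n → ℚ.- seq x n) λ ε 0<ε →
    let k , p = cauchy x ε 0<ε
    in k , λ m n m≥ n≥ → subst (ℚ._≤ ε)
      (trans (sym (ℚ.∣-p∣≡∣p∣ (seq x m ℚ.- seq x n)))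
             (cong ℚ.∣_∣ (ℚ.neg-distrib-+ (seq x m) (ℚ.- seq x n))))
      (p m n m≥ n≥)

-- Division by zero returns 0; only eventually nonzero divisors occur below.
inv : ℚ → ℚ
inv p with p ℚ.≟ 0ℚ
... | yes _   = 0ℚ
... | no  p≢0 = ℚ.1/_ p {{ℚ.≢-nonZero p≢0}}

inv-inverseˡ : ∀ {p} → 0ℚ ℚ.< p → inv p ℚ.* p ≡ 1ℚ
inv-inverseˡ {p} 0<p with p ℚ.≟ 0ℚ
... | yes p≡0 = contradiction (sym p≡0) (ℚ.<⇒≢ 0<p)
... | no  p≢0 = ℚ.*-inverseˡ p {{ℚ.≢-nonZero p≢0}}

private
  inv-pos : ∀ {p} → 0ℚ ℚ.< p → 0ℚ ℚ.< inv p
  inv-pos {p} 0<p = ℚ.*-cancelʳ-<-nonNeg p {{ℚ.nonNegative (ℚ.<⇒≤ 0<p)}}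
    (subst₂ ℚ._<_ (sym (ℚ.*-zeroˡ p)) (sym (inv-inverseˡ 0<p)) (ℚ.positive⁻¹ 1ℚ))

  bounded : ∀ x → ∃[ b ] (0ℚ ℚ.< b × Eventually λ n → ℚ.∣ seq x n ∣ ℚ.≤ b)
  bounded x =
    let k , p = cauchy x 1ℚ (ℚ.positive⁻¹ 1ℚ)
        c = seq x k
        open ℚ.≤-Reasoning
    in 1ℚ ℚ.+ ℚ.∣ c ∣
     , ℚ.<-≤-trans (ℚ.positive⁻¹ 1ℚ)
         (subst (ℚ._≤ 1ℚ ℚ.+ ℚ.∣ c ∣) (ℚ.+-identityʳ 1ℚ) (ℚ.+-monoʳ-≤ 1ℚ (ℚ.0≤∣p∣ c)))
     , k , λ n n≥ → begin
         ℚ.∣ seq x n ∣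
           ≡⟨ cong ℚ.∣_∣ (shift (seq x n) c) ⟩
         ℚ.∣ (seq x n ℚ.- c) ℚ.+ c ∣
           ≤⟨ ℚ.∣p+q∣≤∣p∣+∣q∣ (seq x n ℚ.- c) c ⟩
         ℚ.∣ seq x n ℚ.- c ∣ ℚ.+ ℚ.∣ c ∣
           ≤⟨ ℚ.+-monoˡ-≤ ℚ.∣ c ∣ (p n k n≥ ℕ.≤-refl) ⟩
         1ℚ ℚ.+ ℚ.∣ c ∣ ∎
    where
    open +-*-Solver
    shift : ∀ a c → a ≡ (a ℚ.- c) ℚ.+ c
    shift = solve 2 (λ a c → a := (a :- c) :+ c) refl

opaque
  _*ᴿ_ : ℝ → ℝ → ℝ
  x *ᴿ y = mkℝ (λ n → seq x n ℚ.* seq y n) λ ε 0<ε →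
    let b , 0<b , kb , pb = bounded x
        c , 0<c , kc , pc = bounded y
        δ = ½ ℚ.* ε ℚ.* inv c
        γ = ½ ℚ.* ε ℚ.* inv b
        k , p = cauchy x δ (*-pos (½-pos 0<ε) (inv-pos 0<c))
        l , q = cauchy y γ (*-pos (½-pos 0<ε) (inv-pos 0<b))
        open ℚ.≤-Reasoning
    in (kb ℕ.⊔ kc) ℕ.⊔ (k ℕ.⊔ l) , λ m n m≥ n≥ →
      let m₁ = ℕ.m⊔n≤o⇒m≤o (kb ℕ.⊔ kc) (k ℕ.⊔ l) m≥
          m₂ = ℕ.m⊔n≤o⇒n≤o (kb ℕ.⊔ kc) (k ℕ.⊔ l) m≥
          n₁ = ℕ.m⊔n≤o⇒m≤o (kb ℕ.⊔ kc) (k ℕ.⊔ l) n≥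
          n₂ = ℕ.m⊔n≤o⇒n≤o (kb ℕ.⊔ kc) (k ℕ.⊔ l) n≥
          a = seq x m ; a′ = seq x n ; d = seq y m ; d′ = seq y n
      in begin
      ℚ.∣ a ℚ.* d ℚ.- a′ ℚ.* d′ ∣
        ≡⟨ cong ℚ.∣_∣ (rearrange a d a′ d′) ⟩
      ℚ.∣ (a ℚ.- a′) ℚ.* d′ ℚ.+ (d ℚ.- d′) ℚ.* a ∣
        ≤⟨ ℚ.∣p+q∣≤∣p∣+∣q∣ ((a ℚ.- a′) ℚ.* d′) ((d ℚ.- d′) ℚ.* a) ⟩
      ℚ.∣ (a ℚ.- a′) ℚ.* d′ ∣ ℚ.+ ℚ.∣ (d ℚ.- d′) ℚ.* a ∣
        ≡⟨ cong₂ ℚ._+_ (ℚ.∣p*q∣≡∣p∣*∣q∣ (a ℚ.- a′) d′) (ℚ.∣p*q∣≡∣p∣*∣q∣ (d ℚ.- d′) a) ⟩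
      ℚ.∣ a ℚ.- a′ ∣ ℚ.* ℚ.∣ d′ ∣ ℚ.+ ℚ.∣ d ℚ.- d′ ∣ ℚ.* ℚ.∣ a ∣
        ≤⟨ ℚ.+-mono-≤
             (*-mono-≤ (ℚ.0≤∣p∣ d′) (ℚ.<⇒≤ (*-pos (½-pos 0<ε) (inv-pos 0<c)))
               (p m n (ℕ.m⊔n≤o⇒m≤o k l m₂) (ℕ.m⊔n≤o⇒m≤o k l n₂))
               (pc n (ℕ.m⊔n≤o⇒n≤o kb kc n₁)))
             (*-mono-≤ (ℚ.0≤∣p∣ a) (ℚ.<⇒≤ (*-pos (½-pos 0<ε) (inv-pos 0<b)))
               (q m n (ℕ.m⊔n≤o⇒n≤o k l m₂) (ℕ.m⊔n≤o⇒n≤o k l n₂))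
               (pb m (ℕ.m⊔n≤o⇒m≤o kb kc m₁))) ⟩
      δ ℚ.* c ℚ.+ γ ℚ.* b
        ≡⟨ cong₂ ℚ._+_ (cancel (½ ℚ.* ε) 0<c) (cancel (½ ℚ.* ε) 0<b) ⟩
      ½ ℚ.* ε ℚ.+ ½ ℚ.* ε
        ≡⟨ halves ε ⟩
      ε ∎
    where
    open +-*-Solver
    rearrange : ∀ a d a′ d′ →
      a ℚ.* d ℚ.- a′ ℚ.* d′ ≡ (a ℚ.- a′) ℚ.* d′ ℚ.+ (d ℚ.- d′) ℚ.* a
    rearrange = solve 4 (λ a d a′ d′ →
      a :* d :- a′ :* d′ := (a :- a′) :* d′ :+ (d :- d′) :* a) refl
    cancel : ∀ p {c} → 0ℚ ℚ.< c → p ℚ.* inv c ℚ.* c ≡ p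
    cancel p {c} 0<c = trans (ℚ.*-assoc p (inv c) c)
      (trans (cong (p ℚ.*_) (inv-inverseˡ 0<c)) (ℚ.*-identityʳ p))

private
  eventually-≥ : ∀ y {ε} → Eventually (λ n → 0ℚ ℚ.+ ε ℚ.≤ seq y n) →
                 Eventually λ n → ε ℚ.≤ seq y n
  eventually-≥ y {ε} (k , p) =
    k , λ n n≥ → subst (ℚ._≤ seq y n) (ℚ.+-identityˡ ε) (p n n≥)

opaque
  unfolding _<ᴿ_ fromℚ

  recip : (y : ℝ) → 0ᴿ <ᴿ y → ℝ
  recip y (ε , 0<ε , y≥ε) = mkℝ (λ n → inv (seq y n)) λ δ 0<δ →
    let k , p = eventually-≥ y y≥ε
        l , q = cauchy y (δ ℚ.* (ε ℚ.* ε)) (*-pos 0<δ (*-pos 0<ε 0<ε))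
    in k ℕ.⊔ l , λ m n m≥ n≥ →
      close δ (p m (ℕ.m⊔n≤o⇒m≤o k l m≥)) (p n (ℕ.m⊔n≤o⇒m≤o k l n≥))
        (q n m (ℕ.m⊔n≤o⇒n≤o k l n≥) (ℕ.m⊔n≤o⇒n≤o k l m≥))
    where
    open +-*-Solver
    expand : ∀ i j a b → (i ℚ.- j) ℚ.* (a ℚ.* b) ≡ (i ℚ.* a) ℚ.* b ℚ.- (j ℚ.* b) ℚ.* a
    expand = solve 4 (λ i j a b →
      (i :- j) :* (a :* b) := (i :* a) :* b :- (j :* b) :* a) refl
    close : ∀ δ {a b} → ε ℚ.≤ a → ε ℚ.≤ b → ℚ.∣ b ℚ.- a ∣ ℚ.≤ δ ℚ.* (ε ℚ.* ε) →
            ℚ.∣ inv a ℚ.- inv b ∣ ℚ.≤ δ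
    close δ {a} {b} ε≤a ε≤b h =
      ℚ.*-cancelʳ-≤-pos (ε ℚ.* ε) {{ℚ.positive (*-pos 0<ε 0<ε)}} (begin
      ℚ.∣ inv a ℚ.- inv b ∣ ℚ.* (ε ℚ.* ε)
        ≤⟨ ℚ.*-monoˡ-≤-nonNeg ℚ.∣ inv a ℚ.- inv b ∣ {{ℚ.∣-∣-nonNeg (inv a ℚ.- inv b)}}
             (*-mono-≤ (ℚ.<⇒≤ 0<ε) (ℚ.<⇒≤ 0<a) ε≤a ε≤b) ⟩
      ℚ.∣ inv a ℚ.- inv b ∣ ℚ.* (a ℚ.* b)
        ≡⟨ cong (ℚ.∣ inv a ℚ.- inv b ∣ ℚ.*_) (sym (ℚ.0≤p⇒∣p∣≡p (ℚ.<⇒≤ (*-pos 0<a 0<b)))) ⟩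
      ℚ.∣ inv a ℚ.- inv b ∣ ℚ.* ℚ.∣ a ℚ.* b ∣
        ≡⟨ sym (ℚ.∣p*q∣≡∣p∣*∣q∣ (inv a ℚ.- inv b) (a ℚ.* b)) ⟩
      ℚ.∣ (inv a ℚ.- inv b) ℚ.* (a ℚ.* b) ∣
        ≡⟨ cong ℚ.∣_∣ (expand (inv a) (inv b) a b) ⟩
      ℚ.∣ (inv a ℚ.* a) ℚ.* b ℚ.- (inv b ℚ.* b) ℚ.* a ∣
        ≡⟨ cong₂ (λ s t → ℚ.∣ s ℚ.* b ℚ.- t ℚ.* a ∣) (inv-inverseˡ 0<a) (inv-inverseˡ 0<b) ⟩
      ℚ.∣ 1ℚ ℚ.* b ℚ.- 1ℚ ℚ.* a ∣
        ≡⟨ cong₂ (λ s t → ℚ.∣ s ℚ.- t ∣) (ℚ.*-identityˡ b) (ℚ.*-identityˡ a) ⟩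
      ℚ.∣ b ℚ.- a ∣
        ≤⟨ h ⟩
      δ ℚ.* (ε ℚ.* ε) ∎)
      where
      open ℚ.≤-Reasoning
      0<a : 0ℚ ℚ.< a
      0<a = ℚ.<-≤-trans 0<ε ε≤a
      0<b : 0ℚ ℚ.< b
      0<b = ℚ.<-≤-trans 0<ε ε≤b

_/ᴿ_⟨_⟩ : ℝ → (y : ℝ) → 0ᴿ <ᴿ y → ℝ
x /ᴿ y ⟨ y>0 ⟩ = x *ᴿ recip y y>0

opaque
  unfolding _<ᴿ_ fromℚ recip _*ᴿ_

  <ᴿ-≤ᴿ-trans : ∀ {x y z} → x <ᴿ y → y ≤ᴿ z → x <ᴿ z
  <ᴿ-≤ᴿ-trans {x} {y} {z} (ε , 0<ε , x<y) y≤z =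
    η , ½-pos 0<ε , both step x<y (y≤z η (½-pos 0<ε))
    where
    η : ℚ
    η = ½ ℚ.* ε
    open ℚ.≤-Reasoning
    drop : ∀ a → a ℚ.+ η ℚ.+ (ℚ.- η) ≡ a
    drop a = +-*-Solver.solve 2 (λ a η → a :+ η :+ (:- η) := a) refl a η
      where open +-*-Solver
    step : ∀ n → seq x n ℚ.+ ε ℚ.≤ seq y n → seq y n ℚ.≤ seq z n ℚ.+ η →
           seq x n ℚ.+ η ℚ.≤ seq z n
    step n p q = begin
      seq x n ℚ.+ η                         ≡⟨ drop (seq x n ℚ.+ η) ⟨
      seq x n ℚ.+ η ℚ.+ η ℚ.+ (ℚ.- η)       ≡⟨ cong (ℚ._- η) (ℚ.+-assoc (seq x n) η η) ⟩
      seq x n ℚ.+ (η ℚ.+ η) ℚ.+ (ℚ.- η)     ≡⟨ cong (λ e → seq x n ℚ.+ e ℚ.- η) (halves ε) ⟩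
      seq x n ℚ.+ ε ℚ.+ (ℚ.- η)             ≤⟨ ℚ.+-monoˡ-≤ (ℚ.- η) (ℚ.≤-trans p q) ⟩
      seq z n ℚ.+ η ℚ.+ (ℚ.- η)             ≡⟨ drop (seq z n) ⟩
      seq z n                               ∎

  ≈ᴿ⇒≤ᴿ : ∀ {x y} → x ≈ᴿ y → x ≤ᴿ y
  ≈ᴿ⇒≤ᴿ {x} {y} x≈y ε 0<ε =
    let k , p = x≈y ε 0<ε
    in k , λ n n≥ → subst (ℚ._≤ seq y n ℚ.+ ε) (undo (seq y n) (seq x n))
         (ℚ.+-monoʳ-≤ (seq y n) (ℚ.≤-trans (≤-∣∣ (seq x n ℚ.- seq y n)) (p n n≥)))
    where
    open +-*-Solver
    undo : ∀ b a → b ℚ.+ (a ℚ.- b) ≡ a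
    undo = solve 2 (λ b a → b :+ (a :- b) := a) refl

  /ᴿ-pos : ∀ {x y} → 0ᴿ <ᴿ x → (y>0 : 0ᴿ <ᴿ y) → 0ᴿ <ᴿ x /ᴿ y ⟨ y>0 ⟩
  /ᴿ-pos {x} {y} (ε , 0<ε , x≥ε) (θ , 0<θ , y≥θ) =
    let b , 0<b , y≤b = bounded y
        y≥θ≤b = both (λ _ → _,_) (eventually-≥ y y≥θ) y≤b
    in ε ℚ.* inv b , *-pos 0<ε (inv-pos 0<b) ,
       both (λ n ε≤x (θ≤y , ∣y∣≤b) → ℚ.≤-trans (ℚ.≤-reflexive (ℚ.+-identityˡ _))
               (*-mono-≤ (ℚ.<⇒≤ (inv-pos 0<b)) (ℚ.≤-trans (ℚ.<⇒≤ 0<ε) ε≤x) ε≤x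
                 (inv-anti (ℚ.<-≤-trans 0<θ θ≤y) 0<b (ℚ.≤-trans (≤-∣∣ (seq y n)) ∣y∣≤b))))
         (eventually-≥ x x≥ε) y≥θ≤b
    where
    open ℚ.≤-Reasoning
    inv-anti : ∀ {a b} → 0ℚ ℚ.< a → 0ℚ ℚ.< b → a ℚ.≤ b → inv b ℚ.≤ inv a
    inv-anti {a} {b} 0<a 0<b a≤b = begin
      inv b                         ≡⟨ ℚ.*-identityʳ (inv b) ⟨
      inv b ℚ.* 1ℚ                  ≡⟨ cong (inv b ℚ.*_) (inv-inverseˡ 0<a) ⟨
      inv b ℚ.* (inv a ℚ.* a)       ≤⟨ *-mono-≤ (ℚ.<⇒≤ (*-pos (inv-pos 0<a) 0<a))
                                         (ℚ.<⇒≤ (inv-pos 0<b)) ℚ.≤-refl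
                                         (ℚ.*-monoˡ-≤-nonNeg (inv a)
                                           {{ℚ.nonNegative (ℚ.<⇒≤ (inv-pos 0<a))}} a≤b) ⟩
      inv b ℚ.* (inv a ℚ.* b)       ≡⟨ swap (inv b) (inv a) b ⟩
      inv a ℚ.* (inv b ℚ.* b)       ≡⟨ cong (inv a ℚ.*_) (inv-inverseˡ 0<b) ⟩
      inv a ℚ.* 1ℚ                  ≡⟨ ℚ.*-identityʳ (inv a) ⟩
      inv a                         ∎
      where
      swap : ∀ i j b → i ℚ.* (j ℚ.* b) ≡ j ℚ.* (i ℚ.* b)
      swap = +-*-Solver.solve 3 (λ i j b → i :* (j :* b) := j :* (i :* b)) refl
        where open +-*-Solver

------------------------------------------------------------------------
-- Matrices, positive semidefiniteness and the Löwner order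

+ᴿ-rawMonoid : RawMonoid 0ℓ 0ℓ
+ᴿ-rawMonoid = record { Carrier = ℝ ; _≈_ = _≈ᴿ_ ; _∙_ = _+ᴿ_ ; ε = 0ᴿ }

open RawMonoidDefs +ᴿ-rawMonoid public using (sum)

Matrix : ℕ → Set
Matrix n = Fin n → Fin n → ℝ

infixl 6 _+ᴹ_ _-ᴹ_
infixr 7 _*ᴹ_
infix  8 _ᵀ
infix  4 _≼_

_+ᴹ_ _-ᴹ_ : ∀ {n} → Matrix n → Matrix n → Matrix n
(A +ᴹ B) k l = A k l +ᴿ B k l
(A -ᴹ B) k l = A k l +ᴿ -ᴿ B k l

_*ᴹ_ : ∀ {n} → ℝ → Matrix n → Matrix n
(c *ᴹ A) k l = c *ᴿ A k l

_ᵀ : ∀ {n} → Matrix n → Matrix n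
(A ᵀ) k l = A l k

Id : ∀ {n} → Matrix n
Id k l = if does (k Fin.≟ l) then 1ᴿ else 0ᴿ

_·_ : ∀ {n} → Matrix n → Vector ℝ n → Vector ℝ n
(A · x) k = sum (λ l → A k l *ᴿ x l)

⟨_,_⟩ : ∀ {n} → Vector ℝ n → Vector ℝ n → ℝ
⟨ x , y ⟩ = sum (λ k → x k *ᴿ y k)

PSD : ∀ {n} → Matrix n → Set
PSD A = (∀ k l → A k l ≈ᴿ (A ᵀ) k l) × (∀ x → 0ᴿ ≤ᴿ ⟨ x , A · x ⟩)

_≼_ : ∀ {n} → Matrix n → Matrix n → Set
A ≼ B = PSD (B -ᴹ A)

sumOver : ∀ {m n} → Subset m → (Fin m → Matrix n) → Matrix n
sumOver T A k l = sum (λ j → if does (j ∈? T) then A j k l else 0ᴿ)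

------------------------------------------------------------------------
-- The connectivity parameter

-- The smallest k with P k, if one exists with k ≤ b, and otherwise b + 1.
data IsSmallestUpTo (b : ℕ) (P : ℕ → Set) : ℕ → Set where
  smallest : ∀ {k} → k ℕ.≤ b → P k → (∀ j → P j → k ℕ.≤ j) → IsSmallestUpTo b P k
  none     : (∀ k → k ℕ.≤ b → ¬ P k) → IsSmallestUpTo b P (suc b)

-- Without excluded middle the parameter defined below cannot be computed, since
-- _≼_ is undecidable; the two lemmas say that it is never absent and is unique.
module _ {b : ℕ} {P : ℕ → Set} where

  smallestUpTo-¬¬exists : ¬ ¬ ∃ (IsSmallestUpTo b P)
  smallestUpTo-¬¬exists ¬∃ =
    search (suc b) λ below → ¬∃ (_ , none λ k k≤b → below k (ℕ.s≤s k≤b))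
    where
    NoneBelow : ℕ → Set
    NoneBelow c = ∀ k → k ℕ.< c → ¬ P k

    ¬least : ∀ c → NoneBelow c → ¬ P c
    ¬least c below p with c ℕ.≤? b
    ... | yes c≤b = ¬∃ (c , smallest c≤b p λ j q → ℕ.≮⇒≥ λ j<c → below j j<c q)
    ... | no  c≰b = ¬∃ (_ , none λ k k≤b → below k (ℕ.≤-<-trans k≤b (ℕ.≰⇒> c≰b)))

    extend : ∀ c → NoneBelow c → ¬ P c → NoneBelow (suc c)
    extend c below ¬p k k<1+c q with k ℕ.≟ c
    ... | yes refl = ¬p q
    ... | no  k≢c  = below k (ℕ.≤∧≢⇒< (ℕ.s≤s⁻¹ k<1+c) k≢c) q

    search : ∀ c → ¬ ¬ NoneBelow c
    search zero    ¬below = ¬below λ _ ()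
    search (suc c) ¬below = search c λ below →
      ¬below (extend c below (¬least c below))

  smallestUpTo-unique : ∀ {k l} → IsSmallestUpTo b P k → IsSmallestUpTo b P l → k ≡ l
  smallestUpTo-unique (smallest _ p h) (smallest _ q g) = ℕ.≤-antisym (h _ q) (g _ p)
  smallestUpTo-unique (smallest k≤ p _) (none g) = contradiction p (g _ k≤)
  smallestUpTo-unique (none h) (smallest l≤ q _) = contradiction q (h _ l≤)
  smallestUpTo-unique (none _) (none _) = refl

-- For the family {A i}_{i ∈ I}; the values of A outside I are never used.
module _ {m n : ℕ} (α : ℝ) (I : Subset m) (A : Fin m → Matrix n) where

  Connects : ℕ → Set
  Connects k = ∀ T → T ⊆ I → k ℕ.≤ ∣ T ∣ →
    ∃[ i ] (i ∈ T × (α *ᴹ A i) ≼ sumOver (T - i) A)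

  IsConnectivityParameter : ℕ → Set
  IsConnectivityParameter = IsSmallestUpTo ∣ I ∣ Connects

------------------------------------------------------------------------
-- A group with N elements, listed by Fin N.  A vector of ℝ𝒢 is given by its
-- coordinates in the basis 𝒢.

module FiniteGroup {c ℓ} (𝒢 : Group c ℓ) {N : ℕ}
                   (enum : Inverse (Group.setoid 𝒢) (setoid (Fin N))) where

  open Group 𝒢
  open Inverse enum

  _·ᴳ_ : Fin N → Fin N → Fin N
  h ·ᴳ g = to (from h ∙ from g)

  invᴳ : Fin N → Fin N
  invᴳ g = to (from g ⁻¹)

  SymmetricSubset : Subset N → Set
  SymmetricSubset S = ∀ s → s ∈ S → invᴳ s ∈ S

  -- Column h of the right regular representation of g is the basis vector hg.
  ℛ : Fin N → Matrix N
  ℛ g k h = if does (k Fin.≟ h ·ᴳ g) then 1ᴿ else 0ᴿ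

  L : Fin N → Matrix N
  L g = Id -ᴹ ½ᴿ *ᴹ (ℛ g +ᴹ ℛ g ᵀ)

-- For a group with N elements.
alpha : ℕ → ℝ
alpha N = fromℚ (+ 1 ℚ./ (8 ℕ.* suc ⌈log₂ N ⌉))

------------------------------------------------------------------------
-- Extremal weights; the values of ν outside S are never used.

module _ {N : ℕ} (S : Subset N) (ν : Fin N → ℝ) where

  IsMaximum : ℝ → Set
  IsMaximum M = (∃[ s ] (s ∈ S × ν s ≈ᴿ M))
              × (∀ s → s ∈ S → ν s ≤ᴿ M)

  IsPositiveMinimum : ℝ → Set
  IsPositiveMinimum m = (∃[ s ] (s ∈ S × 0ᴿ <ᴿ ν s × ν s ≈ᴿ m))
                      × (∀ s → s ∈ S → 0ᴿ <ᴿ ν s → m ≤ᴿ ν s)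

  module WeightRatio {M m : ℝ} (isMax : IsMaximum M) (isMin : IsPositiveMinimum m) where

    m>0 : 0ᴿ <ᴿ m
    m>0 = let s , _ , νs>0 , νs≈m = proj₁ isMin
          in <ᴿ-≤ᴿ-trans {0ᴿ} {ν s} {m} νs>0 (≈ᴿ⇒≤ᴿ {ν s} {m} νs≈m)

    M>0 : 0ᴿ <ᴿ M
    M>0 = let s , s∈S , νs>0 , _ = proj₁ isMin
          in <ᴿ-≤ᴿ-trans {0ᴿ} {ν s} {M} νs>0 (proj₂ isMax s s∈S)

    W : ℝ
    W = M /ᴿ m ⟨ m>0 ⟩

    W>0 : 0ᴿ <ᴿ W
    W>0 = /ᴿ-pos {M} {m} M>0 m>0

{-# OPTIONS --safe #-}

-- Write d = ⌈log₂ N⌉ + 1 and let s₁, …, s_d be distinct elements of T.  Since 2^d > N, two of the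
-- 2^d products of subsequences coincide; cancelling up to the first letter t on which they
-- differ gives t a = b with a and b subsequences of the letters after t.  The quadratic form of
-- L_g is half the energy Σ_k (x_k − x_{kg})².  Walking from k to kt along b and then backwards
-- along a, Cauchy–Schwarz bounds the energy of t by 4 d times the energies of the letters after
-- t, which all lie in T \ {t}.  With weights, either some letter of T has weight 0, or all weights
-- lie between m and M and the unweighted inequality is multiplied by m.
module Submission where

open import Defs
open import Algebra.Bundles using (Group; CommutativeRing; CommutativeMonoid)
import Algebra.Properties.CommutativeSemigroup as CommutativeSemigroupProperties
import Algebra.Properties.Group as GroupProperties
open import Data.Bool using (Bool; true; false; if_then_else_)
open import Data.Fin using (Fin; zero; suc; finToFun; funToFin; combine)
open import Data.Fin.Permutation using (Permutation′; permutation)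
import Data.Fin.Properties as Fin
open import Data.Fin.Subset using (Subset; _∈_; _-_; ∣_∣; inside; outside; ⁅_⁆)
open import Data.Fin.Subset.Properties using (_∈?_; p─⊥≡p; p─q⊆p)
open import Data.Integer as ℤ using (+_)
import Data.Integer.Properties as ℤ
open import Data.List using (List; []; _∷_; map; foldl; foldr; length; take)
open import Data.List.Properties using (length-take; length-map; map-∘)
open import Data.List.Relation.Binary.Sublist.Propositional as Sublist
  using ([]; _∷_; _∷ʳ_; ⊆-refl; ⊆-trans) renaming (_⊆_ to _⊑_)
open import Data.List.Relation.Binary.Sublist.Propositional.Properties using (take-⊆; length-mono-≤)
open import Data.List.Relation.Unary.All as All using (All; []; _∷_)
import Data.List.Relation.Unary.All.Properties as All
open import Data.List.Relation.Unary.Any using (here)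
open import Data.Nat as ℕ using (ℕ; zero; suc; _^_; _+_; _≤_)
open import Data.Nat.Induction using (<-rec)
open import Data.Nat.Logarithm using (⌈log₂_⌉; ⌈log₂⌉-mono-≤; ⌈log₂⌈n/2⌉⌉≡⌈log₂n⌉∸1)
import Data.Nat.Properties as ℕ
open import Data.Product using (_×_; _,_; ∃-syntax; proj₂)
open import Data.Rational as ℚ using (ℚ; 0ℚ; 1ℚ; ½)
import Data.Rational.Properties as ℚ
open import Data.Rational.Solver using (module +-*-Solver)
import Data.Rational.Unnormalised as ℚᵘ
import Data.Rational.Unnormalised.Properties as ℚᵘ
open import Data.Sum using (inj₁; inj₂)
open import Data.Vec using ([]; _∷_; here; there)
open import Effect.Monad using (RawMonad)
open import Function using (_∘_; case_of_)
open import Function.Bundles using (Inverse; mk⇔)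
open import Relation.Binary.PropositionalEquality
open import Relation.Nullary using (¬_; ¬?; Dec; yes; no; does; contradiction)
open import Relation.Nullary.Decidable using (does-⇔; decidable-stable; ¬¬-excluded-middle; _×-dec_)
open import Relation.Nullary.Negation using (¬¬-Monad; ¬¬-map)

open import Algebra.Properties.Semiring.Sum (CommutativeRing.semiring ℚ.+-*-commutativeRing)
  using (sum-cong-≗; ∑-distrib-+; ∑-comm; sum-permute; *-distribˡ-sum; *-distribʳ-sum)
  renaming (sum to ∑)
open import Algebra.Properties.Semiring.Mult (CommutativeRing.semiring ℚ.+-*-commutativeRing)
  using (×1-homo-*) renaming (_×_ to _×ℚ_)
open CommutativeSemigroupProperties (CommutativeMonoid.commutativeSemigroup ℚ.+-0-commutativeMonoid)
  using () renaming (x∙yz≈y∙xz to +-swap)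
open CommutativeSemigroupProperties (CommutativeMonoid.commutativeSemigroup ℚ.*-1-commutativeMonoid)
  using () renaming (x∙yz≈y∙xz to *-swap)

-- Reals are Cauchy sequences, so the combinatorial argument is carried out as an exact inequality
-- between rationals, valid for all rational vectors, and then applied to the n-th approximations of
-- a real vector. Only comparisons between weights hold merely in the limit. Positivity of a real
-- weight is undecidable, but the bound to be proved is an inequality of natural numbers, so the
-- split on the weights may take place under a double negation.

-- Binary logarithms

n≤2^⌈log₂n⌉ : ∀ n → n ℕ.≤ 2 ^ ⌈log₂ n ⌉
n≤2^⌈log₂n⌉ = <-rec _ step
  where
  open ℕ.≤-Reasoning
  step : ∀ n → (∀ {m} → m ℕ.< n → m ℕ.≤ 2 ^ ⌈log₂ m ⌉) → n ℕ.≤ 2 ^ ⌈log₂ n ⌉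
  step 0               _   = ℕ.z≤n
  step 1               _   = ℕ.≤-refl
  step n@(suc (suc m)) rec = begin
    n                                   ≡⟨ ℕ.⌊n/2⌋+⌈n/2⌉≡n n ⟨
    ℕ.⌊ n /2⌋ ℕ.+ ℕ.⌈ n /2⌉             ≤⟨ ℕ.+-monoˡ-≤ _ (ℕ.⌊n/2⌋≤⌈n/2⌉ n) ⟩
    ℕ.⌈ n /2⌉ ℕ.+ ℕ.⌈ n /2⌉             ≡⟨ cong (ℕ.⌈ n /2⌉ ℕ.+_) (ℕ.+-identityʳ _) ⟨
    2 ℕ.* ℕ.⌈ n /2⌉                     ≤⟨ ℕ.*-monoʳ-≤ 2 (rec (ℕ.⌈n/2⌉<n m)) ⟩
    2 ^ suc ⌈log₂ ℕ.⌈ n /2⌉ ⌉           ≡⟨ cong (λ e → 2 ^ suc e) (⌈log₂⌈n/2⌉⌉≡⌈log₂n⌉∸1 n) ⟩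
    -- The predecessor is truncated; it is undone by `suc` because n ≥ 2 makes the logarithm
    -- positive.
    2 ^ suc (ℕ.pred ⌈log₂ n ⌉)          ≡⟨ cong (2 ^_) (ℕ.suc-pred ⌈log₂ n ⌉ {{ℕ.>-nonZero 0<log}}) ⟩
    2 ^ ⌈log₂ n ⌉                       ∎
    where
    0<log : 0 ℕ.< ⌈log₂ n ⌉
    0<log = ⌈log₂⌉-mono-≤ {2} {n} (ℕ.s≤s (ℕ.s≤s ℕ.z≤n))

-- The pigeonhole needs strictness, and 2 ^ ⌈log₂ n⌉ equals n at powers of two; hence the extra
-- letter in `d`.
n<2^[1+⌈log₂n⌉] : ∀ n .{{_ : ℕ.NonZero n}} → n ℕ.< 2 ^ suc ⌈log₂ n ⌉
n<2^[1+⌈log₂n⌉] n@(suc _) = begin-strict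
  n                                ≤⟨ n≤2^⌈log₂n⌉ n ⟩
  2 ^ ⌈log₂ n ⌉                    <⟨ ℕ.^-monoʳ-< 2 (ℕ.s≤s (ℕ.s≤s ℕ.z≤n)) (ℕ.n<1+n ⌈log₂ n ⌉) ⟩
  2 ^ suc ⌈log₂ n ⌉                ∎
  where open ℕ.≤-Reasoning

-- Ordered-field facts about ℚ

square : ℚ → ℚ
square p = p ℚ.* p

*-nonneg : ∀ {p q} → 0ℚ ℚ.≤ p → 0ℚ ℚ.≤ q → 0ℚ ℚ.≤ p ℚ.* q
*-nonneg {p} {q} 0≤p 0≤q = ℚ.nonNegative⁻¹ (p ℚ.* q)
  {{ℚ.nonNeg*nonNeg⇒nonNeg p {{ℚ.nonNegative 0≤p}} q {{ℚ.nonNegative 0≤q}}}}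

+-nonneg : ∀ {p q} → 0ℚ ℚ.≤ p → 0ℚ ℚ.≤ q → 0ℚ ℚ.≤ p ℚ.+ q
+-nonneg = ℚ.+-mono-≤

square-nonneg : ∀ p → 0ℚ ℚ.≤ square p
square-nonneg p = subst (0ℚ ℚ.≤_) ∣p∣*∣p∣≡p*p (*-nonneg (ℚ.0≤∣p∣ p) (ℚ.0≤∣p∣ p))
  where
  ∣p∣*∣p∣≡p*p : ℚ.∣ p ∣ ℚ.* ℚ.∣ p ∣ ≡ p ℚ.* p
  ∣p∣*∣p∣≡p*p with ℚ.∣p∣≡p∨∣p∣≡-p p
  ... | inj₁ e = cong₂ ℚ._*_ e e
  ... | inj₂ e = trans (cong₂ ℚ._*_ e e) (neg-square p)
    where
    open +-*-Solver
    neg-square : ∀ p → (ℚ.- p) ℚ.* (ℚ.- p) ≡ p ℚ.* p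
    neg-square = solve 1 (λ p → (:- p) :* (:- p) := p :* p) refl

p≤q⇒0≤q-p : ∀ {p q} → p ℚ.≤ q → 0ℚ ℚ.≤ q ℚ.- p
p≤q⇒0≤q-p {p} {q} p≤q = subst (ℚ._≤ q ℚ.- p) (ℚ.+-inverseʳ p) (ℚ.+-monoˡ-≤ (ℚ.- p) p≤q)

p≤∣p∣ : ∀ p → p ℚ.≤ ℚ.∣ p ∣
p≤∣p∣ p with ℚ.≤-total 0ℚ p
... | inj₁ 0≤p = ℚ.≤-reflexive (sym (ℚ.0≤p⇒∣p∣≡p 0≤p))
... | inj₂ p≤0 = ℚ.≤-trans p≤0 (ℚ.0≤∣p∣ p)

≤-by-difference : ∀ {p q} r → 0ℚ ℚ.≤ r → q ≡ p ℚ.+ r → p ℚ.≤ q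
≤-by-difference {p} r 0≤r refl =
  subst (ℚ._≤ p ℚ.+ r) (ℚ.+-identityʳ p) (ℚ.+-monoʳ-≤ p 0≤r)

*-mono-≤ : ∀ {p q r s} → 0ℚ ℚ.≤ r → 0ℚ ℚ.≤ q → p ℚ.≤ q → r ℚ.≤ s → p ℚ.* r ℚ.≤ q ℚ.* s
*-mono-≤ {q = q} {r} 0≤r 0≤q p≤q r≤s = ℚ.≤-trans
  (ℚ.*-monoʳ-≤-nonNeg r {{ℚ.nonNegative 0≤r}} p≤q)
  (ℚ.*-monoˡ-≤-nonNeg q {{ℚ.nonNegative 0≤q}} r≤s)

-- Sums of rationals

∑-mono-≤ : ∀ {n} {f g : Fin n → ℚ} → (∀ k → f k ℚ.≤ g k) → ∑ f ℚ.≤ ∑ g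
∑-mono-≤ {zero}  f≤g = ℚ.≤-refl
∑-mono-≤ {suc n} f≤g = ℚ.+-mono-≤ (f≤g zero) (∑-mono-≤ (f≤g ∘ suc))

∑-nonneg : ∀ {n} {f : Fin n → ℚ} → (∀ k → 0ℚ ℚ.≤ f k) → 0ℚ ℚ.≤ ∑ f
∑-nonneg {zero}  0≤f = ℚ.≤-refl
∑-nonneg {suc n} 0≤f = +-nonneg (0≤f zero) (∑-nonneg (0≤f ∘ suc))

δ : Bool → ℚ
δ b = if b then 1ℚ else 0ℚ

δ-nonneg : ∀ b → 0ℚ ℚ.≤ δ b
δ-nonneg true  = ℚ.nonNegative⁻¹ 1ℚ
δ-nonneg false = ℚ.≤-refl

∑-zero : ∀ {n} (f : Fin n → ℚ) → ∑ (λ k → 0ℚ ℚ.* f k) ≡ 0ℚ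
∑-zero f = trans (sym (*-distribˡ-sum 0ℚ f)) (ℚ.*-zeroˡ (∑ f))

∑-δˡ : ∀ {n} (k : Fin n) (f : Fin n → ℚ) → ∑ (λ l → δ (does (k Fin.≟ l)) ℚ.* f l) ≡ f k
∑-δˡ zero    f = trans (cong₂ ℚ._+_ (ℚ.*-identityˡ (f zero)) (∑-zero (f ∘ suc))) (ℚ.+-identityʳ (f zero))
∑-δˡ (suc k) f = trans (cong₂ ℚ._+_ (ℚ.*-zeroˡ (f zero)) (∑-δˡ k (f ∘ suc))) (ℚ.+-identityˡ (f (suc k)))

∑-δʳ : ∀ {n} (l : Fin n) (f : Fin n → ℚ) → ∑ (λ k → δ (does (k Fin.≟ l)) ℚ.* f k) ≡ f l
∑-δʳ zero    f = trans (cong₂ ℚ._+_ (ℚ.*-identityˡ (f zero)) (∑-zero (f ∘ suc))) (ℚ.+-identityʳ (f zero))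
∑-δʳ (suc l) f = trans (cong₂ ℚ._+_ (ℚ.*-zeroˡ (f zero)) (∑-δʳ l (f ∘ suc))) (ℚ.+-identityˡ (f (suc l)))

∑∈ : ∀ {n} → Subset n → (Fin n → ℚ) → ℚ
∑∈ T f = ∑ λ j → δ (does (j ∈? T)) ℚ.* f j

∑∈-remove : ∀ {n} {T : Subset n} {t} → t ∈ T → ∀ f → ∑∈ T f ≡ f t ℚ.+ ∑∈ (T - t) f
-- Removing the head also subtracts the empty set from the tail, so the tail is `T` only up to
-- `p─⊥≡p`.
∑∈-remove {T = inside ∷ T} here f =
  cong₂ ℚ._+_ (ℚ.*-identityˡ (f zero)) (trans (sym (ℚ.+-identityˡ (∑∈ T (f ∘ suc))))
    (cong₂ ℚ._+_ (sym (ℚ.*-zeroˡ (f zero))) (cong (λ U → ∑∈ U (f ∘ suc)) (sym (p─⊥≡p T)))))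
∑∈-remove {T = s ∷ T} {suc t} (there t∈T) f = begin
  h ℚ.+ ∑∈ T (f ∘ suc)                               ≡⟨ cong (h ℚ.+_) (∑∈-remove t∈T (f ∘ suc)) ⟩
  h ℚ.+ (f (suc t) ℚ.+ ∑∈ (T - t) (f ∘ suc))         ≡⟨ +-swap h (f (suc t)) _ ⟩
  f (suc t) ℚ.+ (h ℚ.+ ∑∈ (T - t) (f ∘ suc))         ≡⟨ cong (λ b → f (suc t) ℚ.+ (δ b ℚ.* f zero ℚ.+ ∑∈ (T - t) (f ∘ suc)))
                                                             (zero∈?-remove s) ⟩
  f (suc t) ℚ.+ ∑∈ ((s ∷ T) - suc t) f               ∎
  where
  open ≡-Reasoning
  h = δ (does (zero ∈? (s ∷ T))) ℚ.* f zero
  zero∈?-remove : ∀ s → does (zero ∈? (s ∷ T)) ≡ does (zero ∈? ((s ∷ T) - suc t))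
  zero∈?-remove inside  = refl
  zero∈?-remove outside = refl

-- Sums over lists, and natural numbers as rationals

sumₗ : List ℚ → ℚ
sumₗ = foldr ℚ._+_ 0ℚ

sumₗ-mono-⊑ : ∀ {A : Set} {f : A → ℚ} → (∀ a → 0ℚ ℚ.≤ f a) → ∀ {as bs} → as ⊑ bs →
              sumₗ (map f as) ℚ.≤ sumₗ (map f bs)
sumₗ-mono-⊑ 0≤f []             = ℚ.≤-refl
sumₗ-mono-⊑ {f = f} 0≤f (_∷ʳ_ {as} b p) = subst (ℚ._≤ _) (ℚ.+-identityˡ (sumₗ (map f as)))
  (ℚ.+-mono-≤ (0≤f b) (sumₗ-mono-⊑ 0≤f p))
sumₗ-mono-⊑ {f = f} 0≤f (_∷_ {y = b} refl p) = ℚ.+-monoʳ-≤ (f b) (sumₗ-mono-⊑ 0≤f p)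

sumₗ-nonneg : ∀ {A : Set} {f : A → ℚ} → (∀ a → 0ℚ ℚ.≤ f a) → ∀ as → 0ℚ ℚ.≤ sumₗ (map f as)
sumₗ-nonneg 0≤f []       = ℚ.≤-refl
sumₗ-nonneg 0≤f (a ∷ as) = +-nonneg (0≤f a) (sumₗ-nonneg 0≤f as)

-- Repeated addition of 1 rather than a fraction: `⟦ length (a ∷ as) ⟧` unfolds to `1ℚ` plus
-- `⟦ length as ⟧`, in step with recursion on lists.
⟦_⟧ : ℕ → ℚ
⟦ n ⟧ = n ×ℚ 1ℚ

⟦⟧-nonneg : ∀ n → 0ℚ ℚ.≤ ⟦ n ⟧
⟦⟧-nonneg zero    = ℚ.≤-refl
⟦⟧-nonneg (suc n) = +-nonneg (ℚ.nonNegative⁻¹ 1ℚ) (⟦⟧-nonneg n)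

⟦⟧-mono-≤ : ∀ {m n} → m ℕ.≤ n → ⟦ m ⟧ ℚ.≤ ⟦ n ⟧
⟦⟧-mono-≤ {n = n} ℕ.z≤n = ⟦⟧-nonneg n
⟦⟧-mono-≤ (ℕ.s≤s m≤n) = ℚ.+-monoʳ-≤ 1ℚ (⟦⟧-mono-≤ m≤n)

toℚᵘ-⟦⟧ : ∀ n → ℚ.toℚᵘ ⟦ n ⟧ ℚᵘ.≃ ℚᵘ.mkℚᵘ (+ n) 0
toℚᵘ-⟦⟧ zero    = ℚᵘ.≃-refl
toℚᵘ-⟦⟧ (suc n) = ℚᵘ.≃-trans (ℚ.toℚᵘ-homo-+ 1ℚ ⟦ n ⟧)
  (ℚᵘ.≃-trans (ℚᵘ.+-congʳ ℚᵘ.1ℚᵘ (toℚᵘ-⟦⟧ n)) (ℚᵘ.≃-reflexive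
    (cong (λ i → ℚᵘ.mkℚᵘ (+ 1 ℤ.+ i) 0) (ℤ.*-identityʳ (+ n)))))

1/n*⟦n⟧≡1 : ∀ n .{{_ : ℕ.NonZero n}} → (+ 1 ℚ./ n) ℚ.* ⟦ n ⟧ ≡ 1ℚ
-- Unnormalised fractions involve no gcd, so there the equation reduces to an identity of natural
-- numbers.
1/n*⟦n⟧≡1 (suc n) = ℚ.toℚᵘ-injective (ℚᵘ.≃-trans (ℚ.toℚᵘ-homo-* (+ 1 ℚ./ suc n) ⟦ suc n ⟧)
  (ℚᵘ.≃-trans (ℚᵘ.*-cong (ℚ.toℚᵘ-fromℚᵘ (ℚᵘ.mkℚᵘ (+ 1) n)) (toℚᵘ-⟦⟧ (suc n)))
    (ℚᵘ.*≡* (cong +_ (cong suc (trans (cong (ℕ._* 1) (ℕ.+-identityʳ n)) (trans (ℕ.*-identityʳ n)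
      (sym (trans (ℕ.+-identityʳ _) (ℕ.*-identityʳ n))))))))))

-- Cauchy–Schwarz against the constant vector.
square-sumₗ : ∀ as → square (sumₗ as) ℚ.≤ ⟦ length as ⟧ ℚ.* sumₗ (map square as)
square-sumₗ []       = ℚ.≤-refl
-- The slack for `a ∷ as` is the slack for `as` plus the sum of (b - a)² over b in `as`.
square-sumₗ (a ∷ as) = ≤-by-difference _
  (+-nonneg (p≤q⇒0≤q-p (square-sumₗ as)) (sumₗ-nonneg (λ b → square-nonneg (b ℚ.- a)) as))
  (begin
    (1ℚ ℚ.+ r) ℚ.* (a ℚ.* a ℚ.+ q)
      ≡⟨ rearrange r a q s ⟩
    (a ℚ.+ s) ℚ.* (a ℚ.+ s) ℚ.+ (r ℚ.* q ℚ.- s ℚ.* s ℚ.+ ((r ℚ.* (a ℚ.* a) ℚ.+ q) ℚ.- (a ℚ.* s ℚ.+ a ℚ.* s)))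
      ≡⟨ cong (λ z → (a ℚ.+ s) ℚ.* (a ℚ.+ s) ℚ.+ (r ℚ.* q ℚ.- s ℚ.* s ℚ.+ z)) (sym (variance as)) ⟩
    (a ℚ.+ s) ℚ.* (a ℚ.+ s) ℚ.+ (r ℚ.* q ℚ.- s ℚ.* s ℚ.+ sumₗ (map (λ b → square (b ℚ.- a)) as)) ∎)
  where
  open ≡-Reasoning
  open +-*-Solver using (solve; con; _:+_; _:*_; _:-_; _:=_)
  r = ⟦ length as ⟧
  q = sumₗ (map square as)
  s = sumₗ as
  rearrange : ∀ r a q s → (1ℚ ℚ.+ r) ℚ.* (a ℚ.* a ℚ.+ q) ≡
    (a ℚ.+ s) ℚ.* (a ℚ.+ s) ℚ.+ (r ℚ.* q ℚ.- s ℚ.* s ℚ.+ ((r ℚ.* (a ℚ.* a) ℚ.+ q) ℚ.- (a ℚ.* s ℚ.+ a ℚ.* s)))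
  rearrange = solve 4 (λ r a q s → (con 1ℚ :+ r) :* (a :* a :+ q) :=
    (a :+ s) :* (a :+ s) :+ (r :* q :- s :* s :+ ((r :* (a :* a) :+ q) :- (a :* s :+ a :* s)))) refl
  variance : ∀ bs → sumₗ (map (λ b → square (b ℚ.- a)) bs) ≡
    (⟦ length bs ⟧ ℚ.* (a ℚ.* a) ℚ.+ sumₗ (map square bs)) ℚ.- (a ℚ.* sumₗ bs ℚ.+ a ℚ.* sumₗ bs)
  variance []       = solve 1 (λ a → con 0ℚ := (con 0ℚ :* (a :* a) :+ con 0ℚ) :- (a :* con 0ℚ :+ a :* con 0ℚ)) refl a
  variance (b ∷ bs) = trans (cong (square (b ℚ.- a) ℚ.+_) (variance bs))
    (solve 5 (λ a b l q s → (b :- a) :* (b :- a) :+ ((l :* (a :* a) :+ q) :- (a :* s :+ a :* s)) :=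
       ((con 1ℚ :+ l) :* (a :* a) :+ (b :* b :+ q)) :- (a :* (b :+ s) :+ a :* (b :+ s))) refl
       a b ⟦ length bs ⟧ (sumₗ (map square bs)) (sumₗ bs))

-- Subwords of a list

keep : ∀ {A : Set} → Fin 2 → A → List A → List A
keep zero    _ as = as
keep (suc _) a as = a ∷ as

-- Choices take values in `Fin 2` so that `finToFun` enumerates them by `Fin (2 ^ length as)`, the
-- form the pigeonhole principle needs.
select : ∀ {A : Set} (as : List A) → (Fin (length as) → Fin 2) → List A
select []       c = []
select (a ∷ as) c = keep (c zero) a (select as (c ∘ suc))

select-⊑ : ∀ {A : Set} (as : List A) c → select as c ⊑ as
select-⊑ []       c = []
select-⊑ (a ∷ as) c with c zero
... | zero  = a ∷ʳ select-⊑ as (c ∘ suc)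
... | suc _ = refl ∷ select-⊑ as (c ∘ suc)

-- At the first letter where the choices differ, one of them takes t and the other does not.
first-difference : ∀ {A : Set} (_·_ : A → A → A) (as : List A) c c′ → ¬ (c ≗ c′) → ∀ k →
  foldl _·_ k (select as c) ≡ foldl _·_ k (select as c′) →
  ∃[ t ] ∃[ suf ] ∃[ a ] ∃[ b ] ∃[ h ]
    (t ∷ suf) ⊑ as × a ⊑ suf × b ⊑ suf × foldl _·_ h (t ∷ a) ≡ foldl _·_ h b
first-difference _·_ []       c c′ c≉c′ k e = contradiction (λ ()) c≉c′
first-difference _·_ (t ∷ as) c c′ c≉c′ k e with c zero in p | c′ zero in p′ | e
... | suc zero | zero     | e′ = t , as , _ , _ , k , ⊆-refl , select-⊑ as _ , select-⊑ as _ , e′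
... | zero     | suc zero | e′ = t , as , _ , _ , k , ⊆-refl , select-⊑ as _ , select-⊑ as _ , sym e′
... | zero     | zero     | e′ =
  let t′ , suf , a , b , h , s , rest = first-difference _·_ as (c ∘ suc) (c′ ∘ suc)
        (λ q → c≉c′ λ { zero → trans p (sym p′) ; (suc i) → q i }) k e′
  in t′ , suf , a , b , h , t ∷ʳ s , rest
-- Both words take the letter, so the collision continues from `k · t`. Returning the current point
-- as `h` makes cancellation in a group unnecessary here.
... | suc zero | suc zero | e′ =
  let t′ , suf , a , b , h , s , rest = first-difference _·_ as (c ∘ suc) (c′ ∘ suc)
        (λ q → c≉c′ λ { zero → trans p (sym p′) ; (suc i) → q i }) (k · t) e′
  in t′ , suf , a , b , h , t ∷ʳ s , rest

funToFin-cong : ∀ {m n} {f g : Fin m → Fin n} → f ≗ g → funToFin f ≡ funToFin g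
funToFin-cong {zero}  f≗g = refl
funToFin-cong {suc m} f≗g = cong₂ combine (f≗g zero) (funToFin-cong (f≗g ∘ suc))

subword-collision : ∀ {N} (_·_ : Fin N → Fin N → Fin N) (as : List (Fin N)) →
  N ℕ.< 2 ^ length as → Fin N →
  ∃[ t ] ∃[ suf ] ∃[ a ] ∃[ b ] ∃[ h ]
    (t ∷ suf) ⊑ as × a ⊑ suf × b ⊑ suf × foldl _·_ h (t ∷ a) ≡ foldl _·_ h b
subword-collision _·_ as N<2^l k =
  let i , j , i<j , e = Fin.pigeonhole N<2^l λ i → foldl _·_ k (select as (finToFun i))
  in first-difference _·_ as (finToFun i) (finToFun j)
       -- Distinct indices encode choices that differ somewhere, since `funToFin` recovers the index
       -- and respects pointwise equality.
       (λ i≗j → Fin.<⇒≢ i<j (trans (sym (Fin.funToFin-finToFin {length as} {2} i))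
         (trans (funToFin-cong {length as} i≗j) (Fin.funToFin-finToFin {length as} {2} j)))) k e

-- Subsets as lists

elements : ∀ {n} → Subset n → List (Fin n)
elements []            = []
elements (inside  ∷ T) = zero ∷ map suc (elements T)
elements (outside ∷ T) = map suc (elements T)

length-elements : ∀ {n} (T : Subset n) → length (elements T) ≡ ∣ T ∣
length-elements []            = refl
length-elements (inside  ∷ T) = cong suc (trans (length-map suc (elements T)) (length-elements T))
length-elements (outside ∷ T) = trans (length-map suc (elements T)) (length-elements T)

elements-∈ : ∀ {n} (T : Subset n) → All (_∈ T) (elements T)
elements-∈ []            = []
elements-∈ (inside  ∷ T) = here ∷ All.map⁺ (All.map there (elements-∈ T))
elements-∈ (outside ∷ T) = All.map⁺ (All.map there (elements-∈ T))

sumₗ-elements : ∀ {n} (T : Subset n) f → sumₗ (map f (elements T)) ≡ ∑∈ T f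
sumₗ-elements []            f = refl
sumₗ-elements (inside  ∷ T) f = cong₂ ℚ._+_ (sym (ℚ.*-identityˡ (f zero)))
  (trans (cong sumₗ (sym (map-∘ (elements T)))) (sumₗ-elements T (f ∘ suc)))
sumₗ-elements (outside ∷ T) f = trans (cong sumₗ (sym (map-∘ (elements T))))
  (trans (sumₗ-elements T (f ∘ suc)) (trans (sym (ℚ.+-identityˡ (∑∈ T (f ∘ suc))))
    (cong (ℚ._+ ∑∈ T (f ∘ suc)) (sym (ℚ.*-zeroˡ (f zero))))))

-- Quadratic forms of rational matrices

-- With the entry as the left factor, linearity in the matrix is distributivity, and 0-1 matrices
-- collapse by `∑-δˡ` and `∑-δʳ`.
form : ∀ {n} → (Fin n → Fin n → ℚ) → (Fin n → ℚ) → ℚ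
form A x = ∑ λ k → ∑ λ l → A k l ℚ.* (x k ℚ.* x l)

form-cong : ∀ {n} {A B : Fin n → Fin n → ℚ} → (∀ k l → A k l ≡ B k l) → ∀ x → form A x ≡ form B x
form-cong A≗B x = sum-cong-≗ λ k → sum-cong-≗ λ l → cong (ℚ._* (x k ℚ.* x l)) (A≗B k l)

form-+ : ∀ {n} (A B : Fin n → Fin n → ℚ) x →
         form (λ k l → A k l ℚ.+ B k l) x ≡ form A x ℚ.+ form B x
form-+ A B x = trans
  (sum-cong-≗ λ k → trans
    (sum-cong-≗ λ l → ℚ.*-distribʳ-+ (x k ℚ.* x l) (A k l) (B k l))
    (∑-distrib-+ (λ l → A k l ℚ.* (x k ℚ.* x l)) (λ l → B k l ℚ.* (x k ℚ.* x l))))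
  (∑-distrib-+ (λ k → ∑ λ l → A k l ℚ.* (x k ℚ.* x l)) (λ k → ∑ λ l → B k l ℚ.* (x k ℚ.* x l)))

form-* : ∀ {n} c (A : Fin n → Fin n → ℚ) x → form (λ k l → c ℚ.* A k l) x ≡ c ℚ.* form A x
form-* c A x = sym (trans
  (*-distribˡ-sum c (λ k → ∑ λ l → A k l ℚ.* (x k ℚ.* x l)))
  (sum-cong-≗ λ k → trans
    (*-distribˡ-sum c (λ l → A k l ℚ.* (x k ℚ.* x l)))
    (sum-cong-≗ λ l → sym (ℚ.*-assoc c (A k l) (x k ℚ.* x l)))))

form-neg : ∀ {n} (A : Fin n → Fin n → ℚ) x → form (λ k l → ℚ.- A k l) x ≡ ℚ.- form A x
form-neg A x = trans (form-cong (λ k l → neg≡-1* (A k l)) x)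
  (trans (form-* (ℚ.- 1ℚ) A x) (sym (neg≡-1* (form A x))))
  where
  open +-*-Solver using (solve; con; :-_; _:*_; _:=_)
  neg≡-1* : ∀ p → ℚ.- p ≡ ℚ.- 1ℚ ℚ.* p
  neg≡-1* = solve 1 (λ p → :- p := con (ℚ.- 1ℚ) :* p) refl

form-∑ : ∀ {m n} (A : Fin m → Fin n → Fin n → ℚ) x →
         form (λ k l → ∑ λ j → A j k l) x ≡ ∑ λ j → form (A j) x
form-∑ {m} A x = trans
  (sum-cong-≗ λ k → trans (sum-cong-≗ λ l → distribute k l) (∑-comm λ l j → A j k l ℚ.* (x k ℚ.* x l)))
  (∑-comm λ k j → ∑ λ l → A j k l ℚ.* (x k ℚ.* x l))
  where
  distribute : ∀ k l → (∑ λ j → A j k l) ℚ.* (x k ℚ.* x l) ≡ ∑ λ j → A j k l ℚ.* (x k ℚ.* x l)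
  distribute k l = *-distribʳ-sum (x k ℚ.* x l) (λ j → A j k l)

-- Energies of group elements

module _ {c ℓ} (𝒢 : Group c ℓ) {N : ℕ} (enum : Inverse (Group.setoid 𝒢) (setoid (Fin N))) where

  open FiniteGroup 𝒢 enum
  open Group 𝒢 using (Carrier; _≈_; _∙_; ε; _⁻¹; ∙-cong; ∙-congˡ; ∙-congʳ)
  private module 𝒢 = Group 𝒢
  open Inverse enum using (to; from; to-cong; from-cong; strictlyInverseˡ; strictlyInverseʳ)
  open GroupProperties 𝒢 using (∙-cancelˡ)

  product : List (Fin N) → Carrier
  product = foldr (λ g a → from g ∙ a) ε

  from-foldl : ∀ k w → from (foldl _·ᴳ_ k w) ≈ from k ∙ product w
  from-foldl k []      = 𝒢.sym (𝒢.identityʳ (from k))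
  from-foldl k (g ∷ w) = 𝒢.trans (from-foldl (k ·ᴳ g) w)
    (𝒢.trans (∙-congʳ (strictlyInverseʳ (from k ∙ from g))) (𝒢.assoc (from k) (from g) (product w)))

  -- Walking along a word is right multiplication by its product, so an equality at `h` cancels to
  -- an equality of products. The single collision thereby becomes an identity that can be summed
  -- over all starting points.
  foldl-translate : ∀ {h} w w′ → foldl _·ᴳ_ h w ≡ foldl _·ᴳ_ h w′ →
                    ∀ k → foldl _·ᴳ_ k w ≡ foldl _·ᴳ_ k w′
  foldl-translate {h} w w′ e k = begin
    foldl _·ᴳ_ k w                ≡⟨ strictlyInverseˡ _ ⟨
    to (from (foldl _·ᴳ_ k w))    ≡⟨ to-cong equal ⟩
    to (from (foldl _·ᴳ_ k w′))   ≡⟨ strictlyInverseˡ _ ⟩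
    foldl _·ᴳ_ k w′               ∎
    where
    open ≡-Reasoning
    cancelled : product w ≈ product w′
    cancelled = ∙-cancelˡ (from h) (product w) (product w′)
      (𝒢.trans (𝒢.sym (from-foldl h w)) (𝒢.trans (from-cong e) (from-foldl h w′)))
    equal : from (foldl _·ᴳ_ k w) ≈ from (foldl _·ᴳ_ k w′)
    equal = 𝒢.trans (from-foldl k w) (𝒢.trans (∙-congˡ cancelled) (𝒢.sym (from-foldl k w′)))

  ·ᴳ-permutation : Fin N → Permutation′ N
  ·ᴳ-permutation g = permutation (_·ᴳ g) (λ h → to (from h ∙ from g ⁻¹))
    (λ h → trans (to-cong (𝒢.trans (∙-congʳ (strictlyInverseʳ _)) (𝒢.trans (𝒢.assoc _ _ _)
      (𝒢.trans (∙-congˡ (𝒢.inverseˡ _)) (𝒢.identityʳ _))))) (strictlyInverseˡ h))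
    (λ h → trans (to-cong (𝒢.trans (∙-congʳ (strictlyInverseʳ _)) (𝒢.trans (𝒢.assoc _ _ _)
      (𝒢.trans (∙-congˡ (𝒢.inverseʳ _)) (𝒢.identityʳ _))))) (strictlyInverseˡ h))

  ∑-translate : ∀ g (f : Fin N → ℚ) → ∑ (λ k → f (k ·ᴳ g)) ≡ ∑ f
  ∑-translate g f = sym (sum-permute f (·ᴳ-permutation g))

  module _ (x : Fin N → ℚ) where

    energy : Fin N → ℚ
    energy g = ∑ λ k → square (x k ℚ.- x (k ·ᴳ g))

    energy-nonneg : ∀ g → 0ℚ ℚ.≤ energy g
    energy-nonneg g = ∑-nonneg λ k → square-nonneg (x k ℚ.- x (k ·ᴳ g))

    steps : Fin N → List (Fin N) → List ℚ
    steps k []      = []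
    steps k (g ∷ w) = (x k ℚ.- x (k ·ᴳ g)) ∷ steps (k ·ᴳ g) w

    sumₗ-steps : ∀ k w → sumₗ (steps k w) ≡ x k ℚ.- x (foldl _·ᴳ_ k w)
    sumₗ-steps k []      = sym (ℚ.+-inverseʳ (x k))
    sumₗ-steps k (g ∷ w) = trans (cong (x k ℚ.- x (k ·ᴳ g) ℚ.+_) (sumₗ-steps (k ·ᴳ g) w))
      (telescope (x k) (x (k ·ᴳ g)) (x (foldl _·ᴳ_ (k ·ᴳ g) w)))
      where
      telescope : ∀ a b c → a ℚ.- b ℚ.+ (b ℚ.- c) ≡ a ℚ.- c
      telescope = solve 3 (λ a b c → a :- b :+ (b :- c) := a :- c) refl
        where open +-*-Solver

    length-steps : ∀ k w → length (steps k w) ≡ length w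
    length-steps k []      = refl
    length-steps k (g ∷ w) = cong suc (length-steps (k ·ᴳ g) w)

    -- Each step of the walk starts at a translate of `k`; summing over the whole group absorbs the
    -- translation, so only the letter matters.
    ∑-square-steps : ∀ w → ∑ (λ k → sumₗ (map square (steps k w))) ≡ sumₗ (map energy w)
    ∑-square-steps []      = ∑-zero {N} (λ _ → 0ℚ)
    ∑-square-steps (g ∷ w) = trans
      (∑-distrib-+ (λ k → square (x k ℚ.- x (k ·ᴳ g))) (λ k → sumₗ (map square (steps (k ·ᴳ g) w))))
      (cong (energy g ℚ.+_) (trans
        (∑-translate g λ k → sumₗ (map square (steps k w))) (∑-square-steps w)))

    energy-word : ∀ w → ∑ (λ k → square (x k ℚ.- x (foldl _·ᴳ_ k w))) ℚ.≤
                        ⟦ length w ⟧ ℚ.* sumₗ (map energy w)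
    energy-word w = begin
      ∑ (λ k → square (x k ℚ.- x (foldl _·ᴳ_ k w)))
        ≤⟨ ∑-mono-≤ pointwise ⟩
      ∑ (λ k → ⟦ length w ⟧ ℚ.* sumₗ (map square (steps k w)))
        ≡⟨ *-distribˡ-sum ⟦ length w ⟧ (λ k → sumₗ (map square (steps k w))) ⟨
      ⟦ length w ⟧ ℚ.* ∑ (λ k → sumₗ (map square (steps k w)))
        ≡⟨ cong (⟦ length w ⟧ ℚ.*_) (∑-square-steps w) ⟩
      ⟦ length w ⟧ ℚ.* sumₗ (map energy w) ∎
      where
      open ℚ.≤-Reasoning
      pointwise : ∀ k → square (x k ℚ.- x (foldl _·ᴳ_ k w)) ℚ.≤
                        ⟦ length w ⟧ ℚ.* sumₗ (map square (steps k w))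
      pointwise k = subst₂ (λ s n → square s ℚ.≤ ⟦ n ⟧ ℚ.* sumₗ (map square (steps k w)))
        (sumₗ-steps k w) (length-steps k w) (square-sumₗ (steps k w))

    -- No inverse word is formed: `k` and `k ·ᴳ t` are both compared with the common endpoint of the
    -- walk along `b` from `k` and the walk along `a` from `k ·ᴳ t`. Each comparison costs a factor
    -- 2 and each walk at most `C`, whence the 4.
    energy-collision : ∀ {t suf a b h} → a ⊑ suf → b ⊑ suf →
      foldl _·ᴳ_ h (t ∷ a) ≡ foldl _·ᴳ_ h b →
      energy t ℚ.≤ ⟦ 4 ⟧ ℚ.* (⟦ length suf ⟧ ℚ.* sumₗ (map energy suf))
    energy-collision {t} {suf} {a} {b} a⊑suf b⊑suf e = begin
      energy t
        ≤⟨ ∑-mono-≤ (λ k → subst (λ z → square (x k ℚ.- x (k ·ᴳ t)) ℚ.≤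
              ⟦ 2 ⟧ ℚ.* square (x k ℚ.- x z) ℚ.+ ⟦ 2 ⟧ ℚ.* square (x (k ·ᴳ t) ℚ.- x (foldl _·ᴳ_ (k ·ᴳ t) a)))
              (foldl-translate (t ∷ a) b e k)
              (parallelogram (x k) (x (k ·ᴳ t)) (x (foldl _·ᴳ_ (k ·ᴳ t) a)))) ⟩
      ∑ (λ k → ⟦ 2 ⟧ ℚ.* B k ℚ.+ ⟦ 2 ⟧ ℚ.* A (k ·ᴳ t))
        ≡⟨ ∑-distrib-+ (λ k → ⟦ 2 ⟧ ℚ.* B k) (λ k → ⟦ 2 ⟧ ℚ.* A (k ·ᴳ t)) ⟩
      ∑ (λ k → ⟦ 2 ⟧ ℚ.* B k) ℚ.+ ∑ (λ k → ⟦ 2 ⟧ ℚ.* A (k ·ᴳ t))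
        -- The starting point `k ·ᴳ t` of the walk along `a` runs over the whole group with `k`.
        ≡⟨ cong₂ ℚ._+_ (sym (*-distribˡ-sum ⟦ 2 ⟧ B))
             (trans (∑-translate t λ k → ⟦ 2 ⟧ ℚ.* A k) (sym (*-distribˡ-sum ⟦ 2 ⟧ A))) ⟩
      ⟦ 2 ⟧ ℚ.* ∑ B ℚ.+ ⟦ 2 ⟧ ℚ.* ∑ A
        ≤⟨ ℚ.+-mono-≤ (ℚ.*-monoˡ-≤-nonNeg ⟦ 2 ⟧ (bound b⊑suf)) (ℚ.*-monoˡ-≤-nonNeg ⟦ 2 ⟧ (bound a⊑suf)) ⟩
      ⟦ 2 ⟧ ℚ.* C ℚ.+ ⟦ 2 ⟧ ℚ.* C
        ≡⟨ ℚ.*-distribʳ-+ C ⟦ 2 ⟧ ⟦ 2 ⟧ ⟨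
      ⟦ 4 ⟧ ℚ.* C ∎
      where
      open ℚ.≤-Reasoning
      A B : Fin N → ℚ
      A k = square (x k ℚ.- x (foldl _·ᴳ_ k a))
      B k = square (x k ℚ.- x (foldl _·ᴳ_ k b))
      C = ⟦ length suf ⟧ ℚ.* sumₗ (map energy suf)
      bound : ∀ {w} → w ⊑ suf → ∑ (λ k → square (x k ℚ.- x (foldl _·ᴳ_ k w))) ℚ.≤ C
      bound {w} w⊑suf = ℚ.≤-trans (energy-word w)
        (*-mono-≤ (sumₗ-nonneg energy-nonneg w) (⟦⟧-nonneg (length suf))
          (⟦⟧-mono-≤ (length-mono-≤ w⊑suf)) (sumₗ-mono-⊑ energy-nonneg w⊑suf))
      parallelogram : ∀ p q r →
        square (p ℚ.- q) ℚ.≤ ⟦ 2 ⟧ ℚ.* square (p ℚ.- r) ℚ.+ ⟦ 2 ⟧ ℚ.* square (q ℚ.- r)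
      parallelogram p q r = ≤-by-difference (square (p ℚ.+ q ℚ.- (r ℚ.+ r)))
        (square-nonneg (p ℚ.+ q ℚ.- (r ℚ.+ r))) (expand p q r)
        where
        open +-*-Solver using (solve; con; _:+_; _:*_; _:-_; _:=_)
        expand : ∀ p q r → ⟦ 2 ⟧ ℚ.* square (p ℚ.- r) ℚ.+ ⟦ 2 ⟧ ℚ.* square (q ℚ.- r) ≡
                           square (p ℚ.- q) ℚ.+ square (p ℚ.+ q ℚ.- (r ℚ.+ r))
        expand = solve 3 (λ p q r →
          con ⟦ 2 ⟧ :* ((p :- r) :* (p :- r)) :+ con ⟦ 2 ⟧ :* ((q :- r) :* (q :- r)) :=
          (p :- q) :* (p :- q) :+ (p :+ q :- (r :+ r)) :* (p :+ q :- (r :+ r))) refl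

  -- The letter comes from the multiplication alone and precedes the quantifier over `x`; the Löwner
  -- order needs one index that serves all vectors.
  energy-connects : ∀ (T : Subset N) → suc ⌈log₂ N ⌉ ℕ.≤ ∣ T ∣ →
    ∃[ t ] (t ∈ T × ∀ x → (+ 1 ℚ./ (8 ℕ.* suc ⌈log₂ N ⌉)) ℚ.* energy x t ℚ.≤ ∑∈ (T - t) (energy x))
  energy-connects T d≤∣T∣ =
    let t , suf , a , b , h , s , a⊑suf , b⊑suf , e = subword-collision _·ᴳ_ ts N<2^∣ts∣ (to ε)
        s′ = ⊆-trans s (take-⊆ d (elements T))
        t∈T = All.lookup (elements-∈ T) (Sublist.lookup s′ (here refl))
    in t , t∈T , λ x →
       let 0≤q = energy-nonneg x
           P = sumₗ (map (energy x) suf)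
           R = ∑∈ (T - t) (energy x)
           0≤P = sumₗ-nonneg 0≤q suf
           suf≤R : P ℚ.≤ R
           -- That `suf` avoids `t` is not proved separately: `t ∷ suf` is a sublist of the elements
           -- of `T`, and the energy of `t` cancels from both sums.
           suf≤R = +-cancelˡ-≤ (energy x t) (subst (energy x t ℚ.+ P ℚ.≤_)
             (trans (sumₗ-elements T (energy x)) (∑∈-remove t∈T (energy x))) (sumₗ-mono-⊑ 0≤q s′))
       in begin
         α ℚ.* energy x t
           ≤⟨ ℚ.*-monoˡ-≤-nonNeg α {{α-nonNeg}} (energy-collision x {t} {suf} {a} {b} {h} a⊑suf b⊑suf e) ⟩
         α ℚ.* (⟦ 4 ⟧ ℚ.* (⟦ length suf ⟧ ℚ.* P))
           -- The factor 4 times the length of `suf` is relaxed to 8 times `d`, which `α` cancels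
           -- exactly.
           ≤⟨ ℚ.*-monoˡ-≤-nonNeg α {{α-nonNeg}} (*-mono-≤
                (*-nonneg (⟦⟧-nonneg (length suf)) 0≤P) (⟦⟧-nonneg 8) (⟦⟧-mono-≤ {4} {8} (ℕ.m≤m+n 4 4))
                (*-mono-≤ 0≤P (⟦⟧-nonneg d) (⟦⟧-mono-≤ (∣suf∣≤d s)) suf≤R)) ⟩
         α ℚ.* (⟦ 8 ⟧ ℚ.* (⟦ d ⟧ ℚ.* R))
           ≡⟨ regroup α ⟦ 8 ⟧ ⟦ d ⟧ R ⟩
         α ℚ.* (⟦ 8 ⟧ ℚ.* ⟦ d ⟧) ℚ.* R
           ≡⟨ cong (λ z → α ℚ.* z ℚ.* R) (×1-homo-* 8 d) ⟨
         α ℚ.* ⟦ 8 ℕ.* d ⟧ ℚ.* R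
           ≡⟨ cong (ℚ._* R) (1/n*⟦n⟧≡1 (8 ℕ.* d)) ⟩
         1ℚ ℚ.* R
           ≡⟨ ℚ.*-identityˡ R ⟩
         R ∎
    where
    open ℚ.≤-Reasoning
    d = suc ⌈log₂ N ⌉
    α = + 1 ℚ./ (8 ℕ.* d)
    -- Keeping only `d` letters bounds the Cauchy-Schwarz factor by `d` instead of the size of `T`.
    ts = take d (elements T)
    α-nonNeg : ℚ.NonNegative α
    α-nonNeg = ℚ.normalize-nonNeg 1 (8 ℕ.* d)
    ∣ts∣≡d : length ts ≡ d
    ∣ts∣≡d = trans (length-take d (elements T)) (ℕ.m≤n⇒m⊓n≡m (subst (d ℕ.≤_) (sym (length-elements T)) d≤∣T∣))
    N≢0 : ℕ.NonZero N
    N≢0 = Fin.nonZeroIndex (to ε)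
    N<2^∣ts∣ : N ℕ.< 2 ^ length ts
    N<2^∣ts∣ = subst (λ l → N ℕ.< 2 ^ l) (sym ∣ts∣≡d) (n<2^[1+⌈log₂n⌉] N {{N≢0}})
    ∣suf∣≤d : ∀ {t suf} → (t ∷ suf) ⊑ ts → length suf ℕ.≤ d
    ∣suf∣≤d s = ℕ.≤-trans (ℕ.n≤1+n _) (subst (_ ℕ.≤_) ∣ts∣≡d (length-mono-≤ s))
    regroup : ∀ a b c e → a ℚ.* (b ℚ.* (c ℚ.* e)) ≡ a ℚ.* (b ℚ.* c) ℚ.* e
    regroup = solve 4 (λ a b c e → a :* (b :* (c :* e)) := a :* (b :* c) :* e) refl
      where open +-*-Solver using (solve; _:*_; _:=_)
    +-cancelˡ-≤ : ∀ p {q r} → p ℚ.+ q ℚ.≤ p ℚ.+ r → q ℚ.≤ r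
    +-cancelˡ-≤ p {q} {r} le = subst₂ ℚ._≤_ (undo p q) (undo p r) (ℚ.+-monoʳ-≤ (ℚ.- p) le)
      where
      open +-*-Solver using (solve; _:+_; :-_; _:=_)
      undo : ∀ p q → ℚ.- p ℚ.+ (p ℚ.+ q) ≡ q
      undo = solve 2 (λ p q → (:- p) :+ (p :+ q) := q) refl

  -- The quadratic form of L

  matrixL : Fin N → Fin N → Fin N → ℚ
  matrixL g k l = δ (does (k Fin.≟ l)) ℚ.- ½ ℚ.* (δ (does (k Fin.≟ l ·ᴳ g)) ℚ.+ δ (does (l Fin.≟ k ·ᴳ g)))

  -- Expanding the squares gives 2X - 2Y, because the sum of the squares at `k ·ᴳ g` is again X. A
  -- form does not distinguish `R` from its transpose, so both contribute Y.
  form-matrixL : ∀ g x → form (matrixL g) x ≡ ½ ℚ.* energy x g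
  form-matrixL g x = begin
    form (matrixL g) x
      ≡⟨ form-+ I (λ k l → ℚ.- (½ ℚ.* (R k l ℚ.+ R l k))) x ⟩
    form I x ℚ.+ form (λ k l → ℚ.- (½ ℚ.* (R k l ℚ.+ R l k))) x
      ≡⟨ cong (form I x ℚ.+_) (trans (form-neg (λ k l → ½ ℚ.* (R k l ℚ.+ R l k)) x)
           (cong ℚ.-_ (trans (form-* ½ (λ k l → R k l ℚ.+ R l k) x)
             (cong (½ ℚ.*_) (form-+ R (λ k l → R l k) x))))) ⟩
    form I x ℚ.- ½ ℚ.* (form R x ℚ.+ form (λ k l → R l k) x)
      ≡⟨ cong₂ (λ p q → p ℚ.- ½ ℚ.* q) form-I (cong₂ ℚ._+_ form-R form-Rᵀ) ⟩
    X ℚ.- ½ ℚ.* (Y ℚ.+ Y)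
      ≡⟨ halve X Y ⟩
    ½ ℚ.* (X ℚ.+ (X ℚ.+ ℚ.- ⟦ 2 ⟧ ℚ.* Y))
      ≡⟨ cong (½ ℚ.*_) (sym energy-expand) ⟩
    ½ ℚ.* energy x g ∎
    where
    open ≡-Reasoning
    open +-*-Solver using (solve; con; _:+_; _:*_; _:-_; :-_; _:=_)
    I R : Fin N → Fin N → ℚ
    I k l = δ (does (k Fin.≟ l))
    R k l = δ (does (k Fin.≟ l ·ᴳ g))
    X = ∑ λ k → x k ℚ.* x k
    Y = ∑ λ k → x k ℚ.* x (k ·ᴳ g)
    form-I : form I x ≡ X
    form-I = sum-cong-≗ λ k → ∑-δˡ k (λ l → x k ℚ.* x l)
    form-Rᵀ : form (λ k l → R l k) x ≡ Y
    form-Rᵀ = sum-cong-≗ λ k → ∑-δʳ (k ·ᴳ g) (λ l → x k ℚ.* x l)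
    form-R : form R x ≡ Y
    form-R = trans (∑-comm λ k l → R k l ℚ.* (x k ℚ.* x l))
      (sum-cong-≗ λ l → trans (∑-δʳ (l ·ᴳ g) (λ k → x k ℚ.* x l)) (ℚ.*-comm (x (l ·ᴳ g)) (x l)))
    halve : ∀ p q → p ℚ.- ½ ℚ.* (q ℚ.+ q) ≡ ½ ℚ.* (p ℚ.+ (p ℚ.+ ℚ.- ⟦ 2 ⟧ ℚ.* q))
    halve = solve 2 (λ p q → p :- con ½ :* (q :+ q) := con ½ :* (p :+ (p :+ con (ℚ.- ⟦ 2 ⟧) :* q))) refl
    energy-expand : energy x g ≡ X ℚ.+ (X ℚ.+ ℚ.- ⟦ 2 ⟧ ℚ.* Y)
    energy-expand = trans
      (sum-cong-≗ λ k → solve 2 (λ a b → (a :- b) :* (a :- b) :=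
         a :* a :+ (b :* b :+ con (ℚ.- ⟦ 2 ⟧) :* (a :* b))) refl (x k) (x (k ·ᴳ g)))
      (trans (∑-distrib-+ (λ k → x k ℚ.* x k) (λ k → x (k ·ᴳ g) ℚ.* x (k ·ᴳ g) ℚ.+ ℚ.- ⟦ 2 ⟧ ℚ.* (x k ℚ.* x (k ·ᴳ g))))
      (cong (X ℚ.+_) (trans (∑-distrib-+ (λ k → x (k ·ᴳ g) ℚ.* x (k ·ᴳ g)) (λ k → ℚ.- ⟦ 2 ⟧ ℚ.* (x k ℚ.* x (k ·ᴳ g))))
        (cong₂ ℚ._+_ (∑-translate g λ k → x k ℚ.* x k) (sym (*-distribˡ-sum (ℚ.- ⟦ 2 ⟧) λ k → x k ℚ.* x (k ·ᴳ g)))))))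

form-difference : ∀ {m n} (U : Subset m) (A : Fin m → Fin n → Fin n → ℚ) c (B : Fin n → Fin n → ℚ) x →
  form (λ k l → ∑∈ U (λ j → A j k l) ℚ.- c ℚ.* B k l) x ≡ ∑∈ U (λ j → form (A j) x) ℚ.- c ℚ.* form B x
form-difference U A c B x = trans
  (form-+ (λ k l → ∑∈ U (λ j → A j k l)) (λ k l → ℚ.- (c ℚ.* B k l)) x)
  (cong₂ ℚ._+_
    (trans (form-∑ (λ j k l → δ (does (j ∈? U)) ℚ.* A j k l) x)
      (sum-cong-≗ λ j → form-* (δ (does (j ∈? U))) (A j) x))
    (trans (form-neg (λ k l → c ℚ.* B k l) x) (cong ℚ.-_ (form-* c B x))))

∑∈-+ : ∀ {n} (U : Subset n) f g → ∑∈ U (λ j → f j ℚ.+ g j) ≡ ∑∈ U f ℚ.+ ∑∈ U g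
∑∈-+ U f g = trans (sum-cong-≗ λ j → ℚ.*-distribˡ-+ (δ (does (j ∈? U))) (f j) (g j))
  (∑-distrib-+ (λ j → δ (does (j ∈? U)) ℚ.* f j) (λ j → δ (does (j ∈? U)) ℚ.* g j))

∑∈-* : ∀ {n} (U : Subset n) c f → ∑∈ U (λ j → c ℚ.* f j) ≡ c ℚ.* ∑∈ U f
∑∈-* U c f = sym (trans (*-distribˡ-sum c (λ j → δ (does (j ∈? U)) ℚ.* f j))
  (sum-cong-≗ λ j → *-swap c (δ (does (j ∈? U))) (f j)))

-- Sequences of rationals that are nonnegative in the limit

Eventually-zip : ∀ {P Q R : ℕ → Set} → (∀ n → P n → Q n → R n) →
                 Eventually P → Eventually Q → Eventually R
Eventually-zip f (k , p) (l , q) = k ℕ.⊔ l , λ n k⊔l≤n →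
  f n (p n (ℕ.m⊔n≤o⇒m≤o k l k⊔l≤n)) (q n (ℕ.m⊔n≤o⇒n≤o k l k⊔l≤n))

Eventually-map : ∀ {P Q : ℕ → Set} → (∀ n → P n → Q n) → Eventually P → Eventually Q
Eventually-map f (k , p) = k , λ n k≤n → f n (p n k≤n)

-- The content of `0ᴿ ≤ᴿ x`, stated for bare sequences so that intermediate terms need no Cauchy
-- proof.
LimitNonneg : (ℕ → ℚ) → Set
LimitNonneg s = ∀ ε → 0ℚ ℚ.< ε → Eventually λ n → 0ℚ ℚ.≤ s n ℚ.+ ε

BoundedAbove : (ℕ → ℚ) → Set
BoundedAbove s = ∃[ b ] (0ℚ ℚ.< b × Eventually λ n → s n ℚ.≤ b)

*-pos : ∀ {p q} → 0ℚ ℚ.< p → 0ℚ ℚ.< q → 0ℚ ℚ.< p ℚ.* q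
*-pos {p} {q} 0<p 0<q = subst (ℚ._< p ℚ.* q) (ℚ.*-zeroʳ p) (ℚ.*-monoʳ-<-pos p {{ℚ.positive 0<p}} 0<q)

inv-pos : ∀ {p} → 0ℚ ℚ.< p → 0ℚ ℚ.< inv p
inv-pos {p} 0<p = ℚ.*-cancelʳ-<-nonNeg p {{ℚ.nonNegative (ℚ.<⇒≤ 0<p)}}
  (subst₂ ℚ._<_ (sym (ℚ.*-zeroˡ p)) (sym (inv-inverseˡ 0<p)) (ℚ.positive⁻¹ 1ℚ))

½-pos : ∀ {ε} → 0ℚ ℚ.< ε → 0ℚ ℚ.< ½ ℚ.* ε
½-pos = *-pos (ℚ.positive⁻¹ ½)

LimitNonneg-cong : ∀ {s t} → s ≗ t → LimitNonneg s → LimitNonneg t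
LimitNonneg-cong s≗t 0≤s ε 0<ε =
  Eventually-map (λ n → subst (λ p → 0ℚ ℚ.≤ p ℚ.+ ε) (s≗t n)) (0≤s ε 0<ε)

eventually-nonneg⇒LimitNonneg : ∀ {s} → Eventually (λ n → 0ℚ ℚ.≤ s n) → LimitNonneg s
eventually-nonneg⇒LimitNonneg 0≤s ε 0<ε = Eventually-map (λ n 0≤sn → +-nonneg 0≤sn (ℚ.<⇒≤ 0<ε)) 0≤s

LimitNonneg-0 : LimitNonneg (λ _ → 0ℚ)
LimitNonneg-0 = eventually-nonneg⇒LimitNonneg (0 , λ _ _ → ℚ.≤-refl)

LimitNonneg-+ : ∀ {s t} → LimitNonneg s → LimitNonneg t → LimitNonneg (λ n → s n ℚ.+ t n)
LimitNonneg-+ {s} {t} 0≤s 0≤t ε 0<ε =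
  Eventually-zip (λ n p q → subst (0ℚ ℚ.≤_) (regroup (s n) (t n)) (+-nonneg p q))
    (0≤s (½ ℚ.* ε) (½-pos 0<ε)) (0≤t (½ ℚ.* ε) (½-pos 0<ε))
  where
  open +-*-Solver using (solve; con; _:+_; _:*_; _:=_)
  regroup : ∀ a b → (a ℚ.+ ½ ℚ.* ε) ℚ.+ (b ℚ.+ ½ ℚ.* ε) ≡ a ℚ.+ b ℚ.+ ε
  regroup a b = solve 3 (λ a b ε → (a :+ con ½ :* ε) :+ (b :+ con ½ :* ε) := a :+ b :+ ε) refl a b ε

-- The tolerance of `s` is multiplied by `f`, so it is taken as ε / b for a bound b of `f`. Termwise
-- nonnegativity of `f` allows multiplying s n + η ≥ 0 by it.
LimitNonneg-* : ∀ {s f} → LimitNonneg s → Eventually (λ n → 0ℚ ℚ.≤ f n) → BoundedAbove f →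
                LimitNonneg (λ n → s n ℚ.* f n)
LimitNonneg-* {s} {f} 0≤s 0≤f (b , 0<b , f≤b) ε 0<ε =
  Eventually-zip combined (0≤s η 0<η) (Eventually-zip (λ _ → _,_) 0≤f f≤b)
  where
  open ℚ.≤-Reasoning
  η = ε ℚ.* inv b
  0<η : 0ℚ ℚ.< η
  0<η = *-pos 0<ε (inv-pos 0<b)
  combined : ∀ n → 0ℚ ℚ.≤ s n ℚ.+ η → 0ℚ ℚ.≤ f n × f n ℚ.≤ b → 0ℚ ℚ.≤ s n ℚ.* f n ℚ.+ ε
  combined n 0≤sn+η (0≤fn , fn≤b) = begin
    0ℚ                                  ≤⟨ *-nonneg 0≤sn+η 0≤fn ⟩
    (s n ℚ.+ η) ℚ.* f n                 ≡⟨ ℚ.*-distribʳ-+ (f n) (s n) η ⟩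
    s n ℚ.* f n ℚ.+ η ℚ.* f n           ≤⟨ ℚ.+-monoʳ-≤ (s n ℚ.* f n)
                                             (ℚ.*-monoˡ-≤-nonNeg η {{ℚ.nonNegative (ℚ.<⇒≤ 0<η)}} fn≤b) ⟩
    s n ℚ.* f n ℚ.+ η ℚ.* b             ≡⟨ cong (s n ℚ.* f n ℚ.+_) (trans (ℚ.*-assoc ε (inv b) b)
                                             (trans (cong (ε ℚ.*_) (inv-inverseˡ 0<b)) (ℚ.*-identityʳ ε))) ⟩
    s n ℚ.* f n ℚ.+ ε                   ∎

LimitNonneg-∑ : ∀ {m} {s : Fin m → ℕ → ℚ} → (∀ j → LimitNonneg (s j)) → LimitNonneg (λ n → ∑ λ j → s j n)
LimitNonneg-∑ {zero}      0≤s = LimitNonneg-0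
LimitNonneg-∑ {suc m} {s} 0≤s = LimitNonneg-+ {s zero} {λ n → ∑ λ j → s (suc j) n}
  (0≤s zero) (LimitNonneg-∑ (0≤s ∘ suc))

LimitNonneg-∑∈ : ∀ {m} (U : Subset m) {s : Fin m → ℕ → ℚ} → (∀ j → j ∈ U → LimitNonneg (s j)) →
                 LimitNonneg (λ n → ∑∈ U λ j → s j n)
LimitNonneg-∑∈ U {s} 0≤s = LimitNonneg-∑ term
  where
  term : ∀ j → LimitNonneg (λ n → δ (does (j ∈? U)) ℚ.* s j n)
  term j with j ∈? U
  ... | yes j∈U = LimitNonneg-cong (λ n → sym (ℚ.*-identityˡ (s j n))) (0≤s j j∈U)
  ... | no  _   = LimitNonneg-cong (λ n → sym (ℚ.*-zeroˡ (s j n))) LimitNonneg-0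

-- Real numbers through their sequences

opaque
  unfolding fromℚ _+ᴿ_ _*ᴿ_

  seq-fromℚ : ∀ q n → seq (fromℚ q) n ≡ q
  seq-fromℚ q n = refl

  seq-+ : ∀ x y n → seq (x +ᴿ y) n ≡ seq x n ℚ.+ seq y n
  seq-+ x y n = refl

  seq-neg : ∀ x n → seq (-ᴿ x) n ≡ ℚ.- seq x n
  seq-neg x n = refl

  seq-* : ∀ x y n → seq (x *ᴿ y) n ≡ seq x n ℚ.* seq y n
  seq-* x y n = refl

opaque
  unfolding _≤ᴿ_ fromℚ recip

  ≗⇒≈ᴿ : ∀ {x y} → seq x ≗ seq y → x ≈ᴿ y
  ≗⇒≈ᴿ {x} {y} x≗y ε 0<ε = 0 , λ n _ → subst (λ p → ℚ.∣ p ℚ.- seq y n ∣ ℚ.≤ ε) (sym (x≗y n))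
    (subst (λ p → ℚ.∣ p ∣ ℚ.≤ ε) (sym (ℚ.+-inverseʳ (seq y n))) (ℚ.<⇒≤ 0<ε))

  LimitNonneg⇒0≤ᴿ : ∀ {x} → LimitNonneg (seq x) → 0ᴿ ≤ᴿ x
  LimitNonneg⇒0≤ᴿ 0≤x = 0≤x

  ≤ᴿ⇒LimitNonneg : ∀ {x y} → x ≤ᴿ y → LimitNonneg (λ n → seq y n ℚ.- seq x n)
  ≤ᴿ⇒LimitNonneg {x} {y} x≤y ε 0<ε = Eventually-map
    (λ n le → subst (0ℚ ℚ.≤_) (regroup (seq x n) (seq y n) ε) (p≤q⇒0≤q-p le)) (x≤y ε 0<ε)
    where
    open +-*-Solver using (solve; _:+_; _:-_; _:=_)
    regroup : ∀ a b ε → b ℚ.+ ε ℚ.- a ≡ b ℚ.- a ℚ.+ ε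
    regroup = solve 3 (λ a b ε → b :+ ε :- a := b :- a :+ ε) refl

  0<ᴿ⇒eventually-pos : ∀ {x} → 0ᴿ <ᴿ x → Eventually λ n → 0ℚ ℚ.< seq x n
  0<ᴿ⇒eventually-pos (ε , 0<ε , ε≤x) = Eventually-map
    (λ n le → ℚ.<-≤-trans 0<ε (ℚ.≤-trans (ℚ.≤-reflexive (sym (ℚ.+-identityˡ ε))) le)) ε≤x

  -- If one late term exceeded ε, the Cauchy property would keep all later terms above ε/2, making
  -- `x` positive.
  ¬0<ᴿ⇒LimitNonneg-neg : ∀ {x} → ¬ (0ᴿ <ᴿ x) → LimitNonneg (λ n → ℚ.- seq x n)
  ¬0<ᴿ⇒LimitNonneg-neg {x} x≯0 ε 0<ε =
    let k , close = cauchy x (½ ℚ.* ε) (½-pos 0<ε)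
    in k , λ n k≤n → ℚ.≮⇒≥ λ -xn+ε<0 → x≯0 (positive k close n k≤n -xn+ε<0)
    where
    open ℚ.≤-Reasoning
    open +-*-Solver using (solve; con; :-_; _:+_; _:-_; _:*_; _:=_)
    positive : ∀ k → (∀ i j → k ℕ.≤ i → k ℕ.≤ j → ℚ.∣ seq x i ℚ.- seq x j ∣ ℚ.≤ ½ ℚ.* ε) →
               ∀ n → k ℕ.≤ n → ℚ.- seq x n ℚ.+ ε ℚ.< 0ℚ → 0ᴿ <ᴿ x
    positive k close n k≤n neg = ½ ℚ.* ε , ½-pos 0<ε , k , λ j k≤j → begin
      0ℚ ℚ.+ ½ ℚ.* ε
        ≡⟨ solve 2 (λ a ε → con 0ℚ :+ con ½ :* ε := :- a :+ ε :+ (a :- con ½ :* ε)) refl (seq x n) ε ⟩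
      ℚ.- seq x n ℚ.+ ε ℚ.+ (seq x n ℚ.- ½ ℚ.* ε)
        ≤⟨ ℚ.+-monoˡ-≤ (seq x n ℚ.- ½ ℚ.* ε) (ℚ.<⇒≤ neg) ⟩
      0ℚ ℚ.+ (seq x n ℚ.- ½ ℚ.* ε)
        ≤⟨ ℚ.+-monoʳ-≤ 0ℚ (ℚ.+-monoʳ-≤ (seq x n) (ℚ.neg-antimono-≤
             (ℚ.≤-trans (p≤∣p∣ (seq x n ℚ.- seq x j)) (close n j k≤n k≤j)))) ⟩
      0ℚ ℚ.+ (seq x n ℚ.- (seq x n ℚ.- seq x j))
        ≡⟨ solve 2 (λ a b → con 0ℚ :+ (a :- (a :- b)) := b) refl (seq x n) (seq x j) ⟩
      seq x j ∎

  seq-recip : ∀ y y>0 n → seq (recip y y>0) n ≡ inv (seq y n)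
  seq-recip y (ε , 0<ε , ε≤y) n = refl

seq-bounded : ∀ x → BoundedAbove (seq x)
seq-bounded x =
  let k , close = cauchy x 1ℚ (ℚ.positive⁻¹ 1ℚ)
      c = seq x k
  in 1ℚ ℚ.+ ℚ.∣ c ∣
   , ℚ.<-≤-trans (ℚ.positive⁻¹ 1ℚ) (≤-by-difference ℚ.∣ c ∣ (ℚ.0≤∣p∣ c) refl)
   , k , λ n k≤n → begin
       seq x n                                ≡⟨ shift (seq x n) c ⟩
       (seq x n ℚ.- c) ℚ.+ c                  ≤⟨ ℚ.+-mono-≤ (ℚ.≤-trans (p≤∣p∣ (seq x n ℚ.- c))
                                                  (close n k k≤n ℕ.≤-refl)) (p≤∣p∣ c) ⟩
       1ℚ ℚ.+ ℚ.∣ c ∣                         ∎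
  where
  open ℚ.≤-Reasoning
  open +-*-Solver using (solve; _:+_; _:-_; _:=_)
  shift : ∀ a c → a ≡ (a ℚ.- c) ℚ.+ c
  shift = solve 2 (λ a c → a := (a :- c) :+ c) refl

seq-sum : ∀ {m} (f : Fin m → ℝ) n → seq (sum f) n ≡ ∑ λ k → seq (f k) n
seq-sum {zero}  f n = seq-fromℚ 0ℚ n
seq-sum {suc m} f n = trans (seq-+ (f zero) (sum (f ∘ suc)) n)
  (cong (seq (f zero) n ℚ.+_) (seq-sum (f ∘ suc) n))

seq-form : ∀ {m} (A : Matrix m) x n →
           seq ⟨ x , A · x ⟩ n ≡ form (λ k l → seq (A k l) n) (λ k → seq (x k) n)
seq-form A x n = trans (seq-sum (λ k → x k *ᴿ (A · x) k) n) (sum-cong-≗ λ k → begin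
  seq (x k *ᴿ (A · x) k) n
    ≡⟨ seq-* (x k) ((A · x) k) n ⟩
  seq (x k) n ℚ.* seq ((A · x) k) n
    ≡⟨ cong (seq (x k) n ℚ.*_) (seq-sum (λ l → A k l *ᴿ x l) n) ⟩
  seq (x k) n ℚ.* ∑ (λ l → seq (A k l *ᴿ x l) n)
    ≡⟨ *-distribˡ-sum (seq (x k) n) (λ l → seq (A k l *ᴿ x l) n) ⟩
  ∑ (λ l → seq (x k) n ℚ.* seq (A k l *ᴿ x l) n)
    ≡⟨ sum-cong-≗ (λ l → trans (cong (seq (x k) n ℚ.*_) (seq-* (A k l) (x l) n))
         (*-swap (seq (x k) n) (seq (A k l) n) (seq (x l) n))) ⟩
  ∑ (λ l → seq (A k l) n ℚ.* (seq (x k) n ℚ.* seq (x l) n)) ∎)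
  where
  open ≡-Reasoning

seq-δ : ∀ b n → seq (if b then 1ᴿ else 0ᴿ) n ≡ δ b
seq-δ true  n = seq-fromℚ 1ℚ n
seq-δ false n = seq-fromℚ 0ℚ n

seq-sumOver : ∀ {m N} (U : Subset m) (A : Fin m → Matrix N) k l n →
              seq (sumOver U A k l) n ≡ ∑∈ U λ j → seq (A j k l) n
seq-sumOver U A k l n = trans (seq-sum (λ j → if does (j ∈? U) then A j k l else 0ᴿ) n)
  (sum-cong-≗ λ j → seq-if (does (j ∈? U)) (A j k l))
  where
  seq-if : ∀ b y → seq (if b then y else 0ᴿ) n ≡ δ b ℚ.* seq y n
  seq-if true  y = sym (ℚ.*-identityˡ (seq y n))
  seq-if false y = trans (seq-fromℚ 0ℚ n) (sym (ℚ.*-zeroˡ (seq y n)))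

seq-difference : ∀ {m N} (U : Subset m) (A : Fin m → Matrix N) c B k l n →
  seq ((sumOver U A -ᴹ c *ᴹ B) k l) n ≡ ∑∈ U (λ j → seq (A j k l) n) ℚ.- seq c n ℚ.* seq (B k l) n
seq-difference U A c B k l n = trans (seq-+ (sumOver U A k l) (-ᴿ (c *ᴿ B k l)) n)
  (cong₂ ℚ._+_ (seq-sumOver U A k l n)
    (trans (seq-neg (c *ᴿ B k l) n) (cong ℚ.-_ (seq-* c (B k l) n))))

seq-form-difference : ∀ {m N} (U : Subset m) (A : Fin m → Matrix N) c B x n →
  seq ⟨ x , (sumOver U A -ᴹ c *ᴹ B) · x ⟩ n ≡
  ∑∈ U (λ j → form (λ k l → seq (A j k l) n) (λ k → seq (x k) n))
    ℚ.- seq c n ℚ.* form (λ k l → seq (B k l) n) (λ k → seq (x k) n)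
seq-form-difference U A c B x n = trans (seq-form (sumOver U A -ᴹ c *ᴹ B) x n)
  (trans (form-cong (λ k l → seq-difference U A c B k l n) (λ k → seq (x k) n))
    (form-difference U (λ j k l → seq (A j k l) n) (seq c n) (λ k l → seq (B k l) n) (λ k → seq (x k) n)))

does-≟-sym : ∀ {n} (k l : Fin n) → does (k Fin.≟ l) ≡ does (l Fin.≟ k)
does-≟-sym k l = does-⇔ (mk⇔ sym sym) (k Fin.≟ l) (l Fin.≟ k)

-- Bounding the connectivity parameter

-- An inequality of naturals is decidable, hence stable under double negation, so irrefutability of
-- `Connects` is enough.
connectivityParameter-≤ : ∀ {m n} (α : ℝ) (I : Subset m) (A : Fin m → Matrix n) {d} →
  ¬ ¬ Connects α I A d → ∀ k → IsConnectivityParameter α I A k → k ℕ.≤ d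
connectivityParameter-≤ α I A {d} ¬¬connects k param = decidable-stable (k ℕ.≤? d) λ k≰d →
  ¬¬connects λ connects → k≰d (bound connects param)
  where
  bound : ∀ {k} → Connects α I A d → IsConnectivityParameter α I A k → k ℕ.≤ d
  bound connects (smallest _ _ least) = least d connects
  -- Here the parameter is ∣ I ∣ + 1, and `d` ≤ ∣ I ∣ would make `d` an excluded witness.
  bound connects (none ¬connects) = ℕ.≰⇒> λ d≤∣I∣ → ¬connects d d≤∣I∣ connects

¬¬-Fin : ∀ {n} {P : Fin n → Set} → (∀ i → ¬ ¬ P i) → ¬ ¬ (∀ i → P i)
¬¬-Fin = Fin.sequence (RawMonad.rawApplicative ¬¬-Monad)

-- From rational energies to the Löwner order

module _ {c ℓ} (𝒢 : Group c ℓ) {N : ℕ} (enum : Inverse (Group.setoid 𝒢) (setoid (Fin N))) where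

  open FiniteGroup 𝒢 enum
  private
    E = energy 𝒢 enum
    Lℚ = matrixL 𝒢 enum

  seq-L : ∀ g k l n → seq (L g k l) n ≡ Lℚ g k l
  seq-L g k l n = trans (seq-+ (Id k l) (-ᴿ (½ᴿ *ᴿ (ℛ g k l +ᴿ ℛ g l k))) n)
    (cong₂ ℚ._+_ (seq-δ (does (k Fin.≟ l)) n)
      (trans (seq-neg (½ᴿ *ᴿ (ℛ g k l +ᴿ ℛ g l k)) n) (cong ℚ.-_
        (trans (seq-* ½ᴿ (ℛ g k l +ᴿ ℛ g l k) n) (cong₂ ℚ._*_ (seq-fromℚ ½ n)
          (trans (seq-+ (ℛ g k l) (ℛ g l k) n)
            (cong₂ ℚ._+_ (seq-δ (does (k Fin.≟ l ·ᴳ g)) n) (seq-δ (does (l Fin.≟ k ·ᴳ g)) n))))))))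

  Lℚ-sym : ∀ g k l → Lℚ g k l ≡ Lℚ g l k
  Lℚ-sym g k l = cong₂ (λ b s → δ b ℚ.- ½ ℚ.* s) (does-≟-sym k l)
    (ℚ.+-comm (δ (does (k Fin.≟ l ·ᴳ g))) (δ (does (l Fin.≟ k ·ᴳ g))))

  -- `A` is tied to `w` only through sequences, so that `L` itself, with weight `1ᴿ`, and the
  -- weighted family share one proof.
  module _ (w : Fin N → ℝ) (A : Fin N → Matrix N)
           (A≡wL : ∀ j k l n → seq (A j k l) n ≡ seq (w j) n ℚ.* seq (L j k l) n) where

    -- With F_j the quadratic form of L_j and U = T \ {i},
    -- Σ_{j∈U} w_j F_j − c w_i F_i = Σ_{j∈U} (w_j − m) F_j + m (Σ_{j∈U} F_j − β F_i) + (β m − c w_i) F_i.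
    ≼-sumOver : ∀ (T : Subset N) i c m β →
      LimitNonneg (seq m) →
      (∀ j → j ∈ T → LimitNonneg (λ n → seq (w j) n ℚ.- seq m n)) →
      LimitNonneg (λ n → β ℚ.* seq m n ℚ.- seq c n ℚ.* seq (w i) n) →
      (∀ x → β ℚ.* E x i ℚ.≤ ∑∈ (T - i) (E x)) →
      (c *ᴹ A i) ≼ sumOver (T - i) A
    ≼-sumOver T i c m β 0≤m m≤w cw≤βm βE≤∑E = symmetric , nonneg
      where
      U = T - i
      D = sumOver U A -ᴹ c *ᴹ A i

      A-sym : ∀ j k l n → seq (A j k l) n ≡ seq (A j l k) n
      A-sym j k l n = trans (A≡wL j k l n) (trans (cong (seq (w j) n ℚ.*_)
        (trans (seq-L j k l n) (trans (Lℚ-sym j k l) (sym (seq-L j l k n))))) (sym (A≡wL j l k n)))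

      symmetric : ∀ k l → D k l ≈ᴿ (D ᵀ) k l
      symmetric k l = ≗⇒≈ᴿ {D k l} {D l k} λ n → trans (seq-difference U A c (A i) k l n)
        (trans (cong₂ (λ p q → p ℚ.- seq c n ℚ.* q)
          (sum-cong-≗ λ j → cong (δ (does (j ∈? U)) ℚ.*_) (A-sym j k l n)) (A-sym i k l n))
        (sym (seq-difference U A c (A i) l k n)))

      module _ (x : Fin N → ℝ) where
        F : Fin N → ℕ → ℚ
        F j n = form (λ k l → seq (L j k l) n) (λ k → seq (x k) n)

        F≡½E : ∀ j n → F j n ≡ ½ ℚ.* E (λ k → seq (x k) n) j
        F≡½E j n = trans (form-cong (λ k l → seq-L j k l n) (λ k → seq (x k) n))
          (form-matrixL 𝒢 enum j (λ k → seq (x k) n))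

        0≤F : ∀ j n → 0ℚ ℚ.≤ F j n
        0≤F j n = subst (0ℚ ℚ.≤_) (sym (F≡½E j n))
          (*-nonneg (ℚ.nonNegative⁻¹ ½) (energy-nonneg 𝒢 enum (λ k → seq (x k) n) j))

        -- These are the terms of the real number ⟨ x , L j · x ⟩, and Cauchy sequences are bounded.
        F-bounded : ∀ j → BoundedAbove (F j)
        F-bounded j = let b , 0<b , le = seq-bounded ⟨ x , L j · x ⟩
          in b , 0<b , Eventually-map (λ n → subst (ℚ._≤ b) (seq-form (L j) x n)) le

        gap : ℕ → ℚ
        gap n = ∑∈ U (λ j → F j n) ℚ.- β ℚ.* F i n

        -- Exact at every index: the energy inequality applies to the rational vector of n-th
        -- approximations.
        0≤gap : ∀ n → 0ℚ ℚ.≤ gap n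
        0≤gap n = p≤q⇒0≤q-p (begin
          β ℚ.* F i n                       ≡⟨ cong (β ℚ.*_) (F≡½E i n) ⟩
          β ℚ.* (½ ℚ.* E xₙ i)              ≡⟨ *-swap β ½ (E xₙ i) ⟩
          ½ ℚ.* (β ℚ.* E xₙ i)              ≤⟨ ℚ.*-monoˡ-≤-nonNeg ½ (βE≤∑E xₙ) ⟩
          ½ ℚ.* ∑∈ U (E xₙ)                 ≡⟨ ∑∈-* U ½ (E xₙ) ⟨
          ∑∈ U (λ j → ½ ℚ.* E xₙ j)         ≡⟨ sum-cong-≗ (λ j → cong (δ (does (j ∈? U)) ℚ.*_) (F≡½E j n)) ⟨
          ∑∈ U (λ j → F j n)                ∎)
          where
          open ℚ.≤-Reasoning
          xₙ : Fin N → ℚ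
          xₙ k = seq (x k) n

        gap-bounded : BoundedAbove gap
        gap-bounded = let b , 0<b , le = seq-bounded ⟨ x , (sumOver U L -ᴹ fromℚ β *ᴹ L i) · x ⟩
          in b , 0<b , Eventually-map (λ n → subst (ℚ._≤ b) (trans (seq-form-difference U L (fromℚ β) (L i) x n)
               (cong (λ q → ∑∈ U (λ j → F j n) ℚ.- q ℚ.* F i n) (seq-fromℚ β n)))) le

        form-A : ∀ j n → form (λ k l → seq (A j k l) n) (λ k → seq (x k) n) ≡ seq (w j) n ℚ.* F j n
        form-A j n = trans (form-cong (λ k l → A≡wL j k l n) (λ k → seq (x k) n))
          (form-* (seq (w j) n) (λ k l → seq (L j k l) n) (λ k → seq (x k) n))

        decompose : ∀ n →
          ∑∈ U (λ j → (seq (w j) n ℚ.- seq m n) ℚ.* F j n)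
            ℚ.+ (seq m n ℚ.* gap n ℚ.+ (β ℚ.* seq m n ℚ.- seq c n ℚ.* seq (w i) n) ℚ.* F i n)
          ≡ seq ⟨ x , D · x ⟩ n
        decompose n = begin
          ∑∈ U G ℚ.+ (μ ℚ.* (S ℚ.- β ℚ.* F i n) ℚ.+ (β ℚ.* μ ℚ.- γ ℚ.* ω) ℚ.* F i n)
            ≡⟨ regroup (∑∈ U G) μ S β (F i n) γ ω ⟩
          (∑∈ U G ℚ.+ μ ℚ.* S) ℚ.- γ ℚ.* (ω ℚ.* F i n)
            ≡⟨ cong (λ q → ∑∈ U G ℚ.+ q ℚ.- γ ℚ.* (ω ℚ.* F i n)) (sym (∑∈-* U μ (λ j → F j n))) ⟩
          (∑∈ U G ℚ.+ ∑∈ U (λ j → μ ℚ.* F j n)) ℚ.- γ ℚ.* (ω ℚ.* F i n)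
            ≡⟨ cong (ℚ._- γ ℚ.* (ω ℚ.* F i n)) (sym (∑∈-+ U G (λ j → μ ℚ.* F j n))) ⟩
          ∑∈ U (λ j → G j ℚ.+ μ ℚ.* F j n) ℚ.- γ ℚ.* (ω ℚ.* F i n)
            ≡⟨ cong₂ (λ p q → p ℚ.- γ ℚ.* q)
                 (sum-cong-≗ λ j → cong (δ (does (j ∈? U)) ℚ.*_)
                   (trans (restore (seq (w j) n) μ (F j n)) (sym (form-A j n))))
                 (sym (form-A i n)) ⟩
          ∑∈ U (λ j → form (λ k l → seq (A j k l) n) (λ k → seq (x k) n))
            ℚ.- γ ℚ.* form (λ k l → seq (A i k l) n) (λ k → seq (x k) n)
            ≡⟨ seq-form-difference U A c (A i) x n ⟨
          seq ⟨ x , D · x ⟩ n ∎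
          where
          open ≡-Reasoning
          open +-*-Solver using (solve; _:+_; _:-_; _:*_; _:=_)
          μ = seq m n
          γ = seq c n
          ω = seq (w i) n
          S = ∑∈ U (λ j → F j n)
          G : Fin N → ℚ
          G j = (seq (w j) n ℚ.- μ) ℚ.* F j n
          regroup : ∀ P μ S β f γ ω →
            P ℚ.+ (μ ℚ.* (S ℚ.- β ℚ.* f) ℚ.+ (β ℚ.* μ ℚ.- γ ℚ.* ω) ℚ.* f) ≡
            (P ℚ.+ μ ℚ.* S) ℚ.- γ ℚ.* (ω ℚ.* f)
          regroup = solve 7 (λ P μ S β f γ ω →
            P :+ (μ :* (S :- β :* f) :+ (β :* μ :- γ :* ω) :* f) :=
            (P :+ μ :* S) :- γ :* (ω :* f)) refl
          restore : ∀ a μ f → (a ℚ.- μ) ℚ.* f ℚ.+ μ ℚ.* f ≡ a ℚ.* f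
          restore = solve 3 (λ a μ f → (a :- μ) :* f :+ μ :* f := a :* f) refl

        nonneg : 0ᴿ ≤ᴿ ⟨ x , D · x ⟩
        -- Each of the three terms is a product of a factor nonnegative in the limit, coming from
        -- the weights, and a bounded one that is nonnegative at every index, coming from the forms.
        nonneg = LimitNonneg⇒0≤ᴿ {⟨ x , D · x ⟩} (LimitNonneg-cong decompose
          (LimitNonneg-+ {λ n → ∑∈ U λ j → (seq (w j) n ℚ.- seq m n) ℚ.* F j n}
            (LimitNonneg-∑∈ U λ j j∈U → LimitNonneg-* {λ n → seq (w j) n ℚ.- seq m n}
              (m≤w j (p─q⊆p T ⁅ i ⁆ j∈U)) (0 , λ n _ → 0≤F j n) (F-bounded j))
            (LimitNonneg-+ {λ n → seq m n ℚ.* gap n}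
              (LimitNonneg-* {seq m} 0≤m (0 , λ n _ → 0≤gap n) gap-bounded)
              (LimitNonneg-* {λ n → β ℚ.* seq m n ℚ.- seq c n ℚ.* seq (w i) n}
                cw≤βm (0 , λ n _ → 0≤F i n) (F-bounded i)))))

  d : ℕ
  d = suc ⌈log₂ N ⌉

  β : ℚ
  β = + 1 ℚ./ (8 ℕ.* d)

  -- With all weights and `m` equal to 1 and the scalar equal to `β`, only the middle term of the
  -- decomposition survives.
  L-connects : ∀ S → Connects (alpha N) S L d
  L-connects S T T⊆S d≤∣T∣ =
    let i , i∈T , βE≤∑E = energy-connects 𝒢 enum T d≤∣T∣
    in i , i∈T , ≼-sumOver (λ _ → 1ᴿ) L
      (λ j k l n → sym (trans (cong (ℚ._* seq (L j k l) n) (seq-fromℚ 1ℚ n)) (ℚ.*-identityˡ (seq (L j k l) n))))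
      T i (alpha N) 1ᴿ β
      (eventually-nonneg⇒LimitNonneg (0 , λ n _ → subst (0ℚ ℚ.≤_) (sym (seq-fromℚ 1ℚ n)) (ℚ.nonNegative⁻¹ 1ℚ)))
      (λ _ _ → LimitNonneg-cong (λ n → sym (ℚ.+-inverseʳ (seq 1ᴿ n))) LimitNonneg-0)
      (LimitNonneg-cong (λ n → sym (trans (cong (λ q → β ℚ.* seq 1ᴿ n ℚ.- q ℚ.* seq 1ᴿ n) (seq-fromℚ β n))
         (ℚ.+-inverseʳ (β ℚ.* seq 1ᴿ n)))) LimitNonneg-0)
      βE≤∑E

  -- Weighted families

  module _ {S : Subset N} {ν : Fin N → ℝ} (0≤ν : ∀ s → s ∈ S → 0ᴿ ≤ᴿ ν s)
           {M m : ℝ} (isMax : IsMaximum S ν M) (isMin : IsPositiveMinimum S ν m) where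

    open WeightRatio S ν isMax isMin

    C : ℝ
    C = alpha N /ᴿ W ⟨ W>0 ⟩

    -- `inv` is a true inverse only at nonzero terms, so the identity is claimed only from where the
    -- terms of `M` and `m` are positive.
    C*M≡β*m : Eventually λ n → seq C n ℚ.* seq M n ≡ β ℚ.* seq m n
    C*M≡β*m = Eventually-zip step (0<ᴿ⇒eventually-pos {M} M>0) (0<ᴿ⇒eventually-pos {m} m>0)
      where
      step : ∀ n → 0ℚ ℚ.< seq M n → 0ℚ ℚ.< seq m n → seq C n ℚ.* seq M n ≡ β ℚ.* seq m n
      step n 0<M 0<m = begin
        seq C n ℚ.* seq M n
          ≡⟨ cong (ℚ._* seq M n) (trans (seq-* (alpha N) (recip W W>0) n)
               (cong₂ ℚ._*_ (seq-fromℚ β n) (seq-recip W W>0 n))) ⟩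
        β ℚ.* inv (seq W n) ℚ.* seq M n
          ≡⟨ cong (β ℚ.* inv (seq W n) ℚ.*_) M≡W*m ⟩
        β ℚ.* inv (seq W n) ℚ.* (seq W n ℚ.* seq m n)
          ≡⟨ solve 4 (λ a b c e → a :* b :* (c :* e) := a :* (b :* c) :* e) refl β (inv (seq W n)) (seq W n) (seq m n) ⟩
        β ℚ.* (inv (seq W n) ℚ.* seq W n) ℚ.* seq m n
          ≡⟨ cong (λ q → β ℚ.* q ℚ.* seq m n) (inv-inverseˡ 0<W) ⟩
        β ℚ.* 1ℚ ℚ.* seq m n
          ≡⟨ cong (ℚ._* seq m n) (ℚ.*-identityʳ β) ⟩
        β ℚ.* seq m n ∎
        where
        open ≡-Reasoning
        open +-*-Solver using (solve; _:*_; _:=_)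
        seq-W : seq W n ≡ seq M n ℚ.* inv (seq m n)
        seq-W = trans (seq-* M (recip m m>0) n) (cong (seq M n ℚ.*_) (seq-recip m m>0 n))
        M≡W*m : seq M n ≡ seq W n ℚ.* seq m n
        M≡W*m = sym (trans (cong (ℚ._* seq m n) seq-W) (trans (ℚ.*-assoc (seq M n) (inv (seq m n)) (seq m n))
          (trans (cong (seq M n ℚ.*_) (inv-inverseˡ 0<m)) (ℚ.*-identityʳ (seq M n)))))
        0<W : 0ℚ ℚ.< seq W n
        0<W = subst (0ℚ ℚ.<_) (sym seq-W) (*-pos 0<M (inv-pos 0<m))

    C>0 : Eventually λ n → 0ℚ ℚ.< seq C n
    C>0 = 0<ᴿ⇒eventually-pos {C} (/ᴿ-pos {alpha N} {W} alpha>0 W>0)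
      where
      opaque
        unfolding _<ᴿ_ fromℚ
        alpha>0 : 0ᴿ <ᴿ alpha N
        alpha>0 = β , ℚ.positive⁻¹ β {{ℚ.normalize-pos 1 (8 ℕ.* d)}} , 0 , λ _ _ → ℚ.≤-reflexive (ℚ.+-identityˡ β)

    zero-weight-connects : ∀ T → (∀ {s} → s ∈ T → s ∈ S) → ∀ {i} → ¬ (0ᴿ <ᴿ ν i) →
                           (C *ᴹ (ν i *ᴹ L i)) ≼ sumOver (T - i) (λ s → ν s *ᴹ L s)
    zero-weight-connects T T⊆S {i} ν≯0 = ≼-sumOver ν (λ s → ν s *ᴹ L s) (λ j k l n → seq-* (ν j) (L j k l) n)
      -- Lower bound 0 and factor 0 leave the weighted forms over `T - i` and minus `C` times ν i
      -- times the form of `L i`, which is nonnegative in the limit since ν i is not positive.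
      T i C 0ᴿ 0ℚ
      (LimitNonneg-cong (λ n → sym (seq-fromℚ 0ℚ n)) LimitNonneg-0)
      (λ j j∈T → ≤ᴿ⇒LimitNonneg {0ᴿ} {ν j} (0≤ν j (T⊆S j∈T)))
      (LimitNonneg-cong (λ n → regroup (seq 0ᴿ n) (seq C n) (seq (ν i) n))
        (LimitNonneg-* {λ n → ℚ.- seq (ν i) n} {seq C} (¬0<ᴿ⇒LimitNonneg-neg {ν i} ν≯0)
          (Eventually-map (λ _ → ℚ.<⇒≤) C>0) (seq-bounded C)))
      (λ x → subst (ℚ._≤ ∑∈ (T - i) (E x)) (sym (ℚ.*-zeroˡ (E x i)))
        (∑-nonneg λ j → *-nonneg (δ-nonneg (does (j ∈? (T - i)))) (energy-nonneg 𝒢 enum x j)))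
      where
      open +-*-Solver using (solve; con; :-_; _:-_; _:*_; _:=_)
      regroup : ∀ z c v → (ℚ.- v) ℚ.* c ≡ 0ℚ ℚ.* z ℚ.- c ℚ.* v
      regroup = solve 3 (λ z c v → (:- v) :* c := con 0ℚ :* z :- c :* v) refl

    -- C ν i ≤ C M = β m: dividing by `W` trades the largest weight for the least positive one.
    Cν≤βm : ∀ i → i ∈ S → LimitNonneg (λ n → β ℚ.* seq m n ℚ.- seq C n ℚ.* seq (ν i) n)
    Cν≤βm i i∈S ε 0<ε = Eventually-zip
      (λ n e → subst (λ q → 0ℚ ℚ.≤ q ℚ.+ ε) (trans (regroup (seq M n) (seq (ν i) n) (seq C n))
        (cong (ℚ._- seq C n ℚ.* seq (ν i) n) e)))
      C*M≡β*m
      (LimitNonneg-* {λ n → seq M n ℚ.- seq (ν i) n} {seq C} (≤ᴿ⇒LimitNonneg {ν i} {M} (proj₂ isMax i i∈S))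
        (Eventually-map (λ _ → ℚ.<⇒≤) C>0) (seq-bounded C) ε 0<ε)
      where
      open +-*-Solver using (solve; _:-_; _:*_; _:=_)
      regroup : ∀ M v c → (M ℚ.- v) ℚ.* c ≡ c ℚ.* M ℚ.- c ℚ.* v
      regroup = solve 3 (λ M v c → (M :- v) :* c := c :* M :- c :* v) refl

    positive-weights-connect : ∀ T → (∀ {s} → s ∈ T → s ∈ S) → d ℕ.≤ ∣ T ∣ → (∀ j → j ∈ T → 0ᴿ <ᴿ ν j) →
      ∃[ i ] (i ∈ T × (C *ᴹ (ν i *ᴹ L i)) ≼ sumOver (T - i) (λ s → ν s *ᴹ L s))
    positive-weights-connect T T⊆S d≤∣T∣ ν>0 =
      let i , i∈T , βE≤∑E = energy-connects 𝒢 enum T d≤∣T∣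
      in i , i∈T , ≼-sumOver ν (λ s → ν s *ᴹ L s) (λ j k l n → seq-* (ν j) (L j k l) n)
        T i C m β
        (eventually-nonneg⇒LimitNonneg (Eventually-map (λ _ → ℚ.<⇒≤) (0<ᴿ⇒eventually-pos {m} m>0)))
        (λ j j∈T → ≤ᴿ⇒LimitNonneg {m} {ν j} (proj₂ isMin j (T⊆S j∈T) (ν>0 j j∈T)))
        (Cν≤βm i (T⊆S i∈T))
        βE≤∑E

    -- The minimum `m` bounds only positive weights from below, which forces the case split. The
    -- decisions are an argument because they exist only under a double negation, pushed through the
    -- finite index set by `¬¬-Fin`.
    νL-connects : (∀ s → Dec (0ᴿ <ᴿ ν s)) → Connects C S (λ s → ν s *ᴹ L s) d
    νL-connects ν>0? T T⊆S d≤∣T∣ = case Fin.any? (λ s → (s ∈? T) ×-dec ¬? (ν>0? s)) of λ where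
      (yes (i , i∈T , ν≯0)) → i , i∈T , zero-weight-connects T T⊆S ν≯0
      (no ¬∃ν≯0)            → positive-weights-connect T T⊆S d≤∣T∣ λ j j∈T →
        decidable-stable (ν>0? j) λ ν≯0 → ¬∃ν≯0 (j , j∈T , ν≯0)

lemma4p2 : ∀ {c ℓ} (𝒢 : Group c ℓ) (N : ℕ)
    (enum : Inverse (Group.setoid 𝒢) (setoid (Fin N))) →
    let open FiniteGroup 𝒢 enum in
    (S : Subset N) → SymmetricSubset S →
    (∀ k → IsConnectivityParameter (alpha N) S L k → k ≤ ⌈log₂ N ⌉ + 1)
    ×
    ((ν : Fin N → ℝ) →
    (∀ s → s ∈ S → 0ᴿ ≤ᴿ ν s) →
    (∀ s → s ∈ S → ν s ≈ᴿ ν (invᴳ s)) →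
    ¬ (∀ s → s ∈ S → ν s ≈ᴿ 0ᴿ) →
    (M m : ℝ) (isMax : IsMaximum S ν M) (isMin : IsPositiveMinimum S ν m) →
    let open WeightRatio S ν isMax isMin in
    ∀ k → IsConnectivityParameter (alpha N /ᴿ W ⟨ W>0 ⟩) S (λ s → ν s *ᴹ L s) k →
    k ≤ ⌈log₂ N ⌉ + 1)
lemma4p2 𝒢 N enum S _ =
    (λ k → d⇒ k ∘ connectivityParameter-≤ (alpha N) S L (λ ¬connects → ¬connects (L-connects 𝒢 enum S)) k)
  , λ ν 0≤ν _ _ M m isMax isMin k →
      let open WeightRatio S ν isMax isMin in
      d⇒ k ∘ connectivityParameter-≤ (alpha N /ᴿ W ⟨ W>0 ⟩) S (λ s → ν s *ᴹ L s)
        (¬¬-map (νL-connects 𝒢 enum 0≤ν isMax isMin) (¬¬-Fin λ s → ¬¬-excluded-middle)) k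
  where
  open FiniteGroup 𝒢 enum
  d⇒ : ∀ k → k ≤ suc ⌈log₂ N ⌉ → k ≤ ⌈log₂ N ⌉ + 1
  d⇒ k = subst (k ≤_) (ℕ.+-comm 1 ⌈log₂ N ⌉)
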